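{- Let $M$ be a matroid with rank function $r$. Then $M$ is a fundamental transversal matroid if and only if $$r\Bigl(\bigcap_{X\in\mathcal{F}}X\Bigr)=\sum_{\mathcal{F}'\subseteq\mathcal{F}}(-1)^{|\mathcal{F}'|+1}\,r\Bigl(\bigcup_{X\in\mathcal{F}'}X\Bigr)$$ for all nonempty subsets $\mathcal{F}\subseteq\mathcal{Z}(M)$. Equivalently, $M$ is a fundamental transversal matroid if and only if this equality holds for all nonempty antichains $\mathcal{F}$ in $\mathcal{Z}(M)$; equivalently, if and only if it holds for all nonempty filters $\mathcal{F}$ in $\mathcal{Z}(M)$.
   Context: Matroids have finite ground sets; $E(M)$ is the ground set of $M$. A set $X\subseteq E(M)$ is cyclic if it is a union of circuits of $M$ (equivalently, $M|X$ has no coloops; the empty set is cyclic). $\mathcal{Z}(M)$ is the set of all cyclic flats of $M$, ordered by inclusion; it is a lattice. An antichain in $\mathcal{Z}(M)$ is a subset $\mathcal{F}\subseteq\mathcal{Z}(M)$ no two of whose members are related by inclusion. A filter in $\mathcal{Z}(M)$ is a subset $\mathcal{F}\subseteq\mathcal{Z}(M)$ such that if $A\in\mathcal{F}$, $B\in\mathcal{Z}(M)$ and $A\subseteq B$, then $B\in\mathcal{F}$. In sums over $\mathcal{F}'\subseteq\mathcal{F}$, the empty union is $\emptyset$ (so that term is $0$). A set system on a set $S$ is a finite multiset $(A_1,\ldots,A_s)$ of subsets of $S$. A partial transversal of it is a subset $I\subseteq S$ for which there is an injection $\phi:I\to\{1,\ldots,s\}$ with $x\in A_{\phi(x)}$ for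 all $x\in I$. The partial transversals are the independent sets of a matroid on $S$; such a matroid is called transversal and the set system is a presentation of it. A fundamental transversal matroid is a transversal matroid that has a presentation $(A_1,\ldots,A_s)$ for which no difference $A_i-\bigcup_{j\ne i}A_j$, for $1\le i\le s$, is empty. (Equivalently, $M$ is a matroid having a fundamental basis, that is, a basis $B$ such that each $F\in\mathcal{Z}(M)$ is spanned by $B\cap F$.) -}

module Defs where

open import Data.Fin using (Fin)
import Data.Fin as Fin
open import Data.Fin.Subset
  using (Subset; Nonempty; inside; outside; _∈_; _∉_; _⊆_; _⊂_; _∪_; _─_; ⊥; ⁅_⁆; ⋃; ⋂; ∣_∣)
open import Data.Fin.Subset.Properties using (_⊆?_)
open import Data.Integer using (ℤ; 0ℤ; -1ℤ)
import Data.Integer as ℤ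
open import Data.List using (List; []; _∷_; _++_; map; filter; foldr; length; allFin)
open import Data.List.Extrema.Nat using (max)
import Data.List.Membership.Propositional as List
open import Data.List.Relation.Unary.All using (All)
open import Data.List.Relation.Unary.Unique.Propositional using (Unique)
open import Data.Nat using (ℕ; suc; _<_)
open import Data.Product using (Σ-syntax; ∃; ∃-syntax; _×_; proj₁)
import Data.Vec as Vec
open import Function.Bundles using (_⇔_; _↣_; Injection)
open import Relation.Binary.PropositionalEquality using (_≡_)
open import Relation.Nullary using (¬_; Dec; ¬?; _×-dec_)

-- Independence is decidable, as it always is classically; this makes the
-- rank a computable natural number.
record Matroid (n : ℕ) : Set₁ where
  field
    Indep      : Subset n → Set
    indep?     : ∀ I → Dec (Indep I)
    indep-⊥    : Indep ⊥
    hereditary : ∀ {I J} → J ⊆ I → Indep I → Indep J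
    augment    : ∀ {I J} → Indep I → Indep J → ∣ I ∣ < ∣ J ∣ →
                 ∃[ x ] (x ∈ J × x ∉ I × Indep (I ∪ ⁅ x ⁆))

allSubsets : ∀ n → List (Subset n)
allSubsets 0       = Vec.[] ∷ []
allSubsets (suc n) = map (outside Vec.∷_) (allSubsets n) ++ map (inside Vec.∷_) (allSubsets n)

module _ {n : ℕ} (M : Matroid n) where
  open Matroid M

  rank : Subset n → ℕ
  rank X = max 0 (map ∣_∣ (filter (λ I → (I ⊆? X) ×-dec indep? I) (allSubsets n)))

  IsCircuit : Subset n → Set
  IsCircuit C = ¬ Indep C × (∀ {D} → D ⊂ C → Indep D)

  IsCyclic : Subset n → Set
  IsCyclic X = ∃[ Cs ] (All IsCircuit Cs × X ≡ ⋃ Cs)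

  IsFlat : Subset n → Set
  IsFlat X = ∀ x → rank (X ∪ ⁅ x ⁆) ≡ rank X → x ∈ X

  IsCyclicFlat : Subset n → Set
  IsCyclicFlat X = IsFlat X × IsCyclic X

module _ {n s : ℕ} (A : Fin s → Subset n) where

  IsPartialTransversal : Subset n → Set
  IsPartialTransversal I =
    Σ[ φ ∈ (∃ λ x → x ∈ I) ↣ Fin s ] (∀ x → proj₁ x ∈ A (Injection.to φ x))

  ⋃-others : Fin s → Subset n
  ⋃-others i = ⋃ (map A (filter (λ j → ¬? (j Fin.≟ i)) (allFin s)))

IsPresentation : ∀ {n s} → Matroid n → (Fin s → Subset n) → Set
IsPresentation M A = ∀ I → Matroid.Indep M I ⇔ IsPartialTransversal A I

IsFundamentalTransversal : ∀ {n} → Matroid n → Set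
IsFundamentalTransversal {n} M =
  ∃[ s ] Σ[ A ∈ (Fin s → Subset n) ]
    (IsPresentation M A × (∀ i → Nonempty (A i ─ ⋃-others A i)))

-- On a duplicate-free list, read as a finite set, this lists every subset
-- exactly once.
sublists : ∀ {A : Set} → List A → List (List A)
sublists []       = [] ∷ []
sublists (x ∷ xs) = sublists xs ++ map (x ∷_) (sublists xs)

module _ {n : ℕ} (M : Matroid n) where

  -- A finite set of subsets of the ground set is a duplicate-free list.
  IsSetOfCyclicFlats : List (Subset n) → Set
  IsSetOfCyclicFlats F = Unique F × All (IsCyclicFlat M) F

  IsAntichain : List (Subset n) → Set
  IsAntichain F = ∀ {X Y} → X List.∈ F → Y List.∈ F → X ⊆ Y → X ≡ Y

  IsFilter : List (Subset n) → Set
  IsFilter F = ∀ {X Y} → X List.∈ F → IsCyclicFlat M Y → X ⊆ Y → Y List.∈ F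

  alternatingRankSum : List (Subset n) → ℤ
  alternatingRankSum F =
    foldr ℤ._+_ 0ℤ
      (map (λ F′ → (-1ℤ ℤ.^ suc (length F′)) ℤ.* (ℤ.+ rank M (⋃ F′))) (sublists F))

  RankEquality : List (Subset n) → Set
  RankEquality F = ℤ.+ rank M (⋂ F) ≡ alternatingRankSum F

{-# OPTIONS --safe #-}
module Submission where

-- Necessity: if b i lies in A i only and X is a cyclic flat, then x ∈ X ∩ A i forces b i ∈ X, so
-- unions and intersections Y of cyclic flats satisfy r Y = #{i ∣ b i ∈ Y}, and the equality is the
-- inclusion-exclusion formula.
--
-- Sufficiency: Möbius inversion gives integer weights w on the cyclic flats with r U equal to the
-- total weight of the cyclic flats not containing U, for every cyclic set U. For a cyclic flat Z let
-- W be the intersection of all cyclic flats not contained in Z. The equalities for the filters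
-- {X ∣ X ⊈ Z} and {X ∣ X ⊈ Z} ∪ {Z} give w Z = r W − r (Z ∩ W), hence 0 ≤ w Z ≤ ∣ W ─ Z ∣. Choose
-- w Z elements of W ─ Z for each Z; the union B of these disjoint sets is independent, and B ∩ X spans each
-- cyclic flat X. The matroid is then presented by the sets of elements whose fundamental circuit
-- with respect to B contains a given element of B.

open import Defs
open import Data.Bool.Base using (true; false)
open import Data.Empty using (⊥-elim)
open import Data.Fin using (Fin; zero; suc)
import Data.Fin as Fin
import Data.Fin.Properties as Fin
open import Data.Fin.Properties using (suc-injective; 0≢1+n; all?)
open import Data.Fin.Subset renaming (_-_ to _∖_)
open import Data.Fin.Subset.Induction using (⊂-wellFounded; Acc; acc)
open import Data.Fin.Subset.Properties
open import Data.Integer using (ℤ; 0ℤ; 1ℤ; -1ℤ; +_; -_; _+_; _-_; _*_; _^_; _⊖_)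
import Data.Integer.Properties as ℤₚ
open import Data.Integer.Tactic.RingSolver using (solve-∀)
open import Data.List using (List; []; _∷_; _++_; map; filter; foldr; length; lookup; allFin)
open import Data.List.Extrema.Nat using (xs≤max; argmax-sel)
import Data.List.Membership.Propositional as List
open import Data.List.Membership.Propositional.Properties
  using (∈-map⁺; ∈-map⁻; ∈-filter⁺; ∈-filter⁻; ∈-++⁺ˡ; ∈-++⁺ʳ; ∈-allFin; ∈-lookup)
open import Data.List.Properties using (map-++; map-∘; map-cong)
open import Data.List.Relation.Unary.All as All using (All; []; _∷_)
import Data.List.Relation.Unary.All.Properties as All
open import Data.List.Relation.Unary.AllPairs as AllPairs using (AllPairs; []; _∷_)
import Data.List.Relation.Unary.AllPairs.Properties as AllPairs
open import Data.List.Relation.Unary.Any as Any using (here; there)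
open import Data.List.Relation.Unary.Any.Properties using (lookup-index)
open import Data.List.Relation.Unary.Unique.Propositional using (Unique)
import Data.List.Relation.Unary.Unique.Propositional.Properties as Unique
open import Data.Nat using (ℕ; zero; suc; _≤_; _<_; _∸_; z≤n; s≤s; _≤?_)
import Data.Nat as ℕ
open import Data.Nat.Properties as ℕₚ using (≤-trans; ≤-reflexive; ≤-antisym)
open import Data.Product using (∃-syntax; _×_; _,_; proj₁; proj₂; map₂)
open import Data.Sum using (_⊎_; inj₁; inj₂)
import Data.Unit as Unit
import Data.Vec as Vec
open import Data.Vec using ([]; _∷_; here; there; tail)
open import Data.Vec.Properties using (lookup⇒[]=; []=⇒lookup; lookup∘tabulate)
open import Data.Vec.Properties.WithK using ([]=-irrelevant)
open import Function using (_∘_; case_of_; id)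
open import Function.Bundles using (_⇔_; mk⇔; mk↣; Injection; Equivalence)
open import Relation.Binary using (tri<; tri≈; tri>)
open import Relation.Binary.PropositionalEquality hiding (J)
open import Relation.Nullary using (Dec; yes; no; does; contradiction; ¬_; ¬?; _×-dec_; _→-dec_)
open import Relation.Nullary.Decidable using (dec-true; map′; decidable-stable)
open import Relation.Unary using (Pred; Decidable)

private variable
  n m : ℕ
  p q : Subset n
  x y : Fin n

-- Subsets of a finite set, their sizes, and unions and intersections of lists of them.

x∈p─q⁻ : ∀ (p q : Subset n) → x ∈ p ─ q → x ∈ p × x ∉ q
x∈p─q⁻ (true ∷ p) (false ∷ q) here = here , λ ()
x∈p─q⁻ (s ∷ p) (true ∷ q) (there x∈) with x∈p─q⁻ p q x∈
... | a , b = there a , λ { (there h) → b h }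
x∈p─q⁻ (s ∷ p) (false ∷ q) (there x∈) with x∈p─q⁻ p q x∈
... | a , b = there a , λ { (there h) → b h }

x∈p-y⁻ : ∀ (p : Subset n) y → x ∈ p ∖ y → x ∈ p × x ≢ y
x∈p-y⁻ p y x∈ with x∈p─q⁻ p ⁅ y ⁆ x∈
... | x∈p , x∉y = x∈p , x∉⁅y⁆⇒x≢y x∉y

x∉p-x : ∀ (p : Subset n) x → x ∉ p ∖ x
x∉p-x p x x∈ = proj₂ (x∈p-y⁻ p x x∈) refl

x∈p∪⁅y⁆⁻ : ∀ (p : Subset n) y → x ∈ p ∪ ⁅ y ⁆ → x ∈ p ⊎ x ≡ y
x∈p∪⁅y⁆⁻ p y x∈ with x∈p∪q⁻ p ⁅ y ⁆ x∈
... | inj₁ h = inj₁ h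
... | inj₂ h = inj₂ (x∈⁅y⁆⇒x≡y y h)

x∈p∪⁅x⁆ : ∀ (p : Subset n) x → x ∈ p ∪ ⁅ x ⁆
x∈p∪⁅x⁆ p x = x∈p∪q⁺ (inj₂ (x∈⁅x⁆ x))

∪-lub : ∀ {p q r : Subset n} → p ⊆ r → q ⊆ r → p ∪ q ⊆ r
∪-lub {p = p} {q} p⊆r q⊆r x∈ with x∈p∪q⁻ p q x∈
... | inj₁ h = p⊆r h
... | inj₂ h = q⊆r h

⁅x⁆⊆p : x ∈ p → ⁅ x ⁆ ⊆ p
⁅x⁆⊆p {x = x} {p = p} x∈p y∈ = subst (_∈ p) (sym (x∈⁅y⁆⇒x≡y x y∈)) x∈p

p∪⁅x⁆⊆q : p ⊆ q → x ∈ q → p ∪ ⁅ x ⁆ ⊆ q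
p∪⁅x⁆⊆q p⊆q x∈q = ∪-lub p⊆q (⁅x⁆⊆p x∈q)

∪-monoˡ-⊆ : ∀ {p q : Subset n} r → p ⊆ q → p ∪ r ⊆ q ∪ r
∪-monoˡ-⊆ {q = q} r p⊆q = ∪-lub (p⊆p∪q r ∘ p⊆q) (q⊆p∪q q r)

p⊆[p-x]∪⁅x⁆ : ∀ (p : Subset n) x → p ⊆ (p ∖ x) ∪ ⁅ x ⁆
p⊆[p-x]∪⁅x⁆ p x {y} y∈p with y Fin.≟ x
... | yes refl = x∈p∪⁅x⁆ _ y
... | no y≢x = x∈p∪q⁺ (inj₁ (x∈p∧x≢y⇒x∈p-y y∈p y≢x))

∣p∪⁅x⁆∣≡1+∣p∣ : ∀ (p : Subset n) {x} → x ∉ p → ∣ p ∪ ⁅ x ⁆ ∣ ≡ suc ∣ p ∣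
∣p∪⁅x⁆∣≡1+∣p∣ (true ∷ p) {zero} x∉ = ⊥-elim (x∉ here)
∣p∪⁅x⁆∣≡1+∣p∣ (false ∷ p) {zero} x∉ = cong (suc ∘ ∣_∣) (∪-identityʳ p)
∣p∪⁅x⁆∣≡1+∣p∣ (true ∷ p) {suc x} x∉ = cong suc (∣p∪⁅x⁆∣≡1+∣p∣ p (x∉ ∘ there))
∣p∪⁅x⁆∣≡1+∣p∣ (false ∷ p) {suc x} x∉ = ∣p∪⁅x⁆∣≡1+∣p∣ p (x∉ ∘ there)

∣p∣≡1+∣p-x∣ : ∀ (p : Subset n) {x} → x ∈ p → ∣ p ∣ ≡ suc ∣ p ∖ x ∣
∣p∣≡1+∣p-x∣ p {x} x∈p = trans
  (cong ∣_∣ (⊆-antisym (p⊆[p-x]∪⁅x⁆ p x) (p∪⁅x⁆⊆q (proj₁ ∘ x∈p-y⁻ p x) x∈p)))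
  (∣p∪⁅x⁆∣≡1+∣p∣ (p ∖ x) (x∉p-x p x))

∣p∣≡∣p∩q∣+∣p─q∣ : ∀ (p q : Subset n) → ∣ p ∣ ≡ ∣ p ∩ q ∣ ℕ.+ ∣ p ─ q ∣
∣p∣≡∣p∩q∣+∣p─q∣ [] [] = refl
∣p∣≡∣p∩q∣+∣p─q∣ (false ∷ p) (true ∷ q) = ∣p∣≡∣p∩q∣+∣p─q∣ p q
∣p∣≡∣p∩q∣+∣p─q∣ (false ∷ p) (false ∷ q) = ∣p∣≡∣p∩q∣+∣p─q∣ p q
∣p∣≡∣p∩q∣+∣p─q∣ (true ∷ p) (true ∷ q) = cong suc (∣p∣≡∣p∩q∣+∣p─q∣ p q)
∣p∣≡∣p∩q∣+∣p─q∣ (true ∷ p) (false ∷ q) =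
  trans (cong suc (∣p∣≡∣p∩q∣+∣p─q∣ p q)) (sym (ℕₚ.+-suc _ _))

∣p∪q∣≡∣p∣+∣q∣ : ∀ (p q : Subset n) → (∀ {x} → x ∈ p → x ∉ q) → ∣ p ∪ q ∣ ≡ ∣ p ∣ ℕ.+ ∣ q ∣
∣p∪q∣≡∣p∣+∣q∣ [] [] _ = refl
∣p∪q∣≡∣p∣+∣q∣ (true ∷ p) (true ∷ q) disj = ⊥-elim (disj here here)
∣p∪q∣≡∣p∣+∣q∣ (true ∷ p) (false ∷ q) disj = cong suc (∣p∪q∣≡∣p∣+∣q∣ p q λ a b → disj (there a) (there b))
∣p∪q∣≡∣p∣+∣q∣ (false ∷ p) (true ∷ q) disj =
  trans (cong suc (∣p∪q∣≡∣p∣+∣q∣ p q λ a b → disj (there a) (there b))) (sym (ℕₚ.+-suc _ _))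
∣p∪q∣≡∣p∣+∣q∣ (false ∷ p) (false ∷ q) disj = ∣p∪q∣≡∣p∣+∣q∣ p q λ a b → disj (there a) (there b)

p⊆q∧∣q∣≤∣p∣⇒q⊆p : p ⊆ q → ∣ q ∣ ≤ ∣ p ∣ → q ⊆ p
p⊆q∧∣q∣≤∣p∣⇒q⊆p {p = p} p⊆q ∣q∣≤∣p∣ {x} x∈q with x ∈? p
... | yes x∈p = x∈p
... | no x∉p = contradiction (p⊂q⇒∣p∣<∣q∣ (p⊆q , x , x∈q , x∉p)) (ℕₚ.≤⇒≯ ∣q∣≤∣p∣)

module _ {ℓ} {P : Pred (Fin n) ℓ} (P? : Decidable P) where

  comprehension : Subset n
  comprehension = Vec.tabulate (does ∘ P?)

  ∈-comprehension⁺ : P x → x ∈ comprehension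
  ∈-comprehension⁺ {x} Px = lookup⇒[]= x _
    (trans (lookup∘tabulate (does ∘ P?) x) (dec-true (P? x) Px))

  ∈-comprehension⁻ : x ∈ comprehension → P x
  ∈-comprehension⁻ {x} x∈ with P? x | trans (sym (lookup∘tabulate (does ∘ P?) x)) ([]=⇒lookup x∈)
  ... | yes Px | _ = Px

-- The image of the first member is deleted from `J` before the recursion; injectivity keeps the
-- remaining images inside. `φ` takes a membership proof because matchings are defined on the
-- members of `I` only.
∣∣-injective : ∀ (I : Subset n) (J : Subset m) (φ : ∀ x → x ∈ I → Fin m) →
  (∀ x p → φ x p ∈ J) → (∀ x y p q → φ x p ≡ φ y q → x ≡ y) → ∣ I ∣ ≤ ∣ J ∣
∣∣-injective [] J φ φ∈J inj = z≤n
∣∣-injective (false ∷ I) J φ φ∈J inj =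
  ∣∣-injective I J (λ x p → φ (suc x) (there p)) (λ x p → φ∈J _ _)
    (λ x y p q e → suc-injective (inj _ _ _ _ e))
∣∣-injective (true ∷ I) J φ φ∈J inj = ≤-trans
  (s≤s (∣∣-injective I (J ∖ φ zero here) (λ x p → φ (suc x) (there p))
    (λ x p → x∈p∧x≢y⇒x∈p-y (φ∈J _ _) (λ e → 0≢1+n (sym (inj _ _ _ _ e))))
    (λ x y p q e → suc-injective (inj _ _ _ _ e))))
  (x∈p⇒∣p-x∣<∣p∣ (φ∈J zero here))

subset-of-size : ∀ k (p : Subset n) → k ≤ ∣ p ∣ → ∃[ q ] (q ⊆ p × ∣ q ∣ ≡ k)
subset-of-size {n} zero p _ = ⊥ , ⊥⊆ , ∣⊥∣≡0 n
subset-of-size (suc k) (true ∷ p) (s≤s k≤) with subset-of-size k p k≤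
... | q , q⊆p , e = true ∷ q , s⊆s q⊆p , cong suc e
subset-of-size (suc k) (false ∷ p) k≤ with subset-of-size (suc k) p k≤
... | q , q⊆p , e = false ∷ q , s⊆s q⊆p , e

-- Increasing enumeration; it indexes the presentation built from a basis `B` by `Fin ∣ B ∣`.
nth : (p : Subset n) → Fin ∣ p ∣ → Fin n
nth (true ∷ p) zero = zero
nth (true ∷ p) (suc i) = suc (nth p i)
nth (false ∷ p) i = suc (nth p i)

nth-∈ : ∀ (p : Subset n) i → nth p i ∈ p
nth-∈ (true ∷ p) zero = here
nth-∈ (true ∷ p) (suc i) = there (nth-∈ p i)
nth-∈ (false ∷ p) i = there (nth-∈ p i)

nth-injective : ∀ (p : Subset n) {i j} → nth p i ≡ nth p j → i ≡ j
nth-injective (true ∷ p) {zero} {zero} e = refl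
nth-injective (true ∷ p) {suc i} {suc j} e = cong suc (nth-injective p (suc-injective e))
nth-injective (false ∷ p) e = nth-injective p (suc-injective e)

nth-surjective : ∀ (p : Subset n) {x} → x ∈ p → ∃[ i ] nth p i ≡ x
nth-surjective (true ∷ p) here = zero , refl
nth-surjective (true ∷ p) (there x∈p) with nth-surjective p x∈p
... | i , e = suc i , cong suc e
nth-surjective (false ∷ p) (there x∈p) with nth-surjective p x∈p
... | i , e = i , cong suc e

x∈⋃⁺ : ∀ {X : Subset n} {Xs} → X List.∈ Xs → x ∈ X → x ∈ ⋃ Xs
x∈⋃⁺ (here refl) x∈X = x∈p∪q⁺ (inj₁ x∈X)
x∈⋃⁺ (there X∈) x∈X = x∈p∪q⁺ (inj₂ (x∈⋃⁺ X∈ x∈X))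

x∈⋃⁻ : ∀ (Xs : List (Subset n)) → x ∈ ⋃ Xs → ∃[ X ] (X List.∈ Xs × x ∈ X)
x∈⋃⁻ [] x∈ = contradiction x∈ ∉⊥
x∈⋃⁻ (X ∷ Xs) x∈ with x∈p∪q⁻ X (⋃ Xs) x∈
... | inj₁ h = X , here refl , h
... | inj₂ h with x∈⋃⁻ Xs h
... | Y , Y∈ , x∈Y = Y , there Y∈ , x∈Y

x∈⋂⁺ : ∀ (Xs : List (Subset n)) → (∀ {X} → X List.∈ Xs → x ∈ X) → x ∈ ⋂ Xs
x∈⋂⁺ [] _ = ∈⊤
x∈⋂⁺ (X ∷ Xs) h = x∈p∩q⁺ (h (here refl) , x∈⋂⁺ Xs (h ∘ there))

⋂⊆ : ∀ {X : Subset n} {Xs} → X List.∈ Xs → ⋂ Xs ⊆ X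
⋂⊆ {X = X} {Xs = Y ∷ Xs} (here refl) x∈ = proj₁ (x∈p∩q⁻ X (⋂ Xs) x∈)
⋂⊆ {Xs = Y ∷ Xs} (there X∈) x∈ = ⋂⊆ X∈ (proj₂ (x∈p∩q⁻ Y (⋂ Xs) x∈))

∈-allSubsets : ∀ {n} (p : Subset n) → p List.∈ allSubsets n
∈-allSubsets [] = here refl
∈-allSubsets (true ∷ p) = ∈-++⁺ʳ (map (outside ∷_) (allSubsets _)) (∈-map⁺ (inside ∷_) (∈-allSubsets p))
∈-allSubsets (false ∷ p) = ∈-++⁺ˡ (∈-map⁺ (outside ∷_) (∈-allSubsets p))

∷-⊈ : ∀ {n} {s t} {p q : Subset n} → p ⊈ q → (s ∷ p) ⊈ (t ∷ q)
∷-⊈ p⊈q sp⊆tq = p⊈q (drop-∷-⊆ sp⊆tq)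

-- Sets avoiding the first element are listed before those containing it. The order makes the
-- equations for the weights of the cyclic flats triangular, and it also excludes repetitions.
allSubsets-linear-extension : ∀ n → AllPairs (λ p q → q ⊈ p) (allSubsets n)
allSubsets-linear-extension zero = [] ∷ []
allSubsets-linear-extension (suc n) = AllPairs.++⁺
  (AllPairs.map⁺ (AllPairs.map ∷-⊈ (allSubsets-linear-extension n)))
  (AllPairs.map⁺ (AllPairs.map ∷-⊈ (allSubsets-linear-extension n)))
  (All.map⁺ (All.tabulate λ _ → All.map⁺ (All.tabulate λ _ q⊆p → case q⊆p here of λ ())))

-- Rank, closure, circuits and cyclic sets of a matroid.

module MatroidTheory {n : ℕ} (M : Matroid n) where
  open Matroid M

  private
    variable
      I J X Y : Subset n
    r : Subset n → ℕ
    r = rank M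

  Indep⇒∣I∣≤rank : Indep I → I ⊆ X → ∣ I ∣ ≤ r X
  Indep⇒∣I∣≤rank {I} {X} ind I⊆X = All.lookup (xs≤max 0 _)
    (∈-map⁺ ∣_∣ (∈-filter⁺ (λ I → (I ⊆? X) ×-dec indep? I) (∈-allSubsets I) ((λ {x} → I⊆X {x}) , ind)))

  basis : ∀ X → ∃[ I ] (I ⊆ X × Indep I × ∣ I ∣ ≡ r X)
  basis X with argmax-sel id 0 (map ∣_∣ (filter (λ I → (I ⊆? X) ×-dec indep? I) (allSubsets n)))
  -- The maximum may be the default value 0, which the empty set attains.
  ... | inj₁ e = ⊥ , ⊥⊆ , indep-⊥ , trans (∣⊥∣≡0 n) (sym e)
  ... | inj₂ rX∈ with ∈-map⁻ ∣_∣ rX∈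
  ...   | I , I∈ , e with ∈-filter⁻ (λ I → (I ⊆? X) ×-dec indep? I) {xs = allSubsets n} I∈
  ...     | _ , I⊆X , ind = I , I⊆X , ind , sym e

  rank-mono : X ⊆ Y → r X ≤ r Y
  rank-mono {X} X⊆Y with basis X
  ... | I , I⊆X , ind , e = subst (_≤ _) e (Indep⇒∣I∣≤rank ind (X⊆Y ∘ I⊆X))

  Indep⇒rank≡∣I∣ : Indep I → r I ≡ ∣ I ∣
  Indep⇒rank≡∣I∣ {I} ind with basis I
  ... | J , J⊆I , _ , e = ≤-antisym (subst (_≤ _) e (p⊆q⇒∣p∣≤∣q∣ J⊆I)) (Indep⇒∣I∣≤rank ind id)

  extend-to-basis : Indep I → I ⊆ X → ∃[ K ] (I ⊆ K × K ⊆ X × Indep K × ∣ K ∣ ≡ r X)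
  extend-to-basis {I} {X} ind I⊆X = go (r X) I ind I⊆X (ℕₚ.m≤m+n (r X) ∣ I ∣)
    where
    -- `k` bounds the number of augmentations still possible, as each one raises `∣ I ∣` by one.
    go : ∀ k I → Indep I → I ⊆ X → r X ≤ k ℕ.+ ∣ I ∣ → ∃[ K ] (I ⊆ K × K ⊆ X × Indep K × ∣ K ∣ ≡ r X)
    go k I ind I⊆X rX≤ with basis X
    ... | J , J⊆X , indJ , e with ∣ J ∣ ≤? ∣ I ∣
    ...   | yes J≤I = I , id , I⊆X , ind , ≤-antisym (Indep⇒∣I∣≤rank ind I⊆X) (subst (_≤ _) e J≤I)
    go zero I ind I⊆X rX≤ | J , J⊆X , indJ , e | no J≰I = contradiction (subst (_≤ _) (sym e) rX≤) J≰I
    go (suc k) I ind I⊆X rX≤ | J , J⊆X , indJ , e | no J≰I with augment ind indJ (ℕₚ.≰⇒> J≰I)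
    ... | x , x∈J , x∉I , ind′
      with go k (I ∪ ⁅ x ⁆) ind′ (p∪⁅x⁆⊆q I⊆X (J⊆X x∈J))
             (subst (r X ≤_) (trans (sym (ℕₚ.+-suc k ∣ I ∣)) (cong (k ℕ.+_) (sym (∣p∪⁅x⁆∣≡1+∣p∣ I x∉I)))) rX≤)
    ...   | K , I′⊆K , rest = K , I′⊆K ∘ p⊆p∪q ⁅ x ⁆ , rest

  rank<⇒¬Indep : r X < ∣ I ∣ → I ⊆ X → ¬ Indep I
  rank<⇒¬Indep rX< I⊆X ind = ℕₚ.<⇒≱ rX< (Indep⇒∣I∣≤rank ind I⊆X)

  -- A basis of X augmented from one of X ∪ ⁅ x ⁆ can only gain x, and it contains I.
  flat-augment : IsFlat M X → Indep I → I ⊆ X → x ∉ X → Indep (I ∪ ⁅ x ⁆)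
  flat-augment {X} {I} {x} flat ind I⊆X x∉X with extend-to-basis ind I⊆X | basis (X ∪ ⁅ x ⁆)
  ... | K , I⊆K , K⊆X , indK , K≡ | J , J⊆ , indJ , J≡ with augment indK indJ K<J
    where
    K<J : ∣ K ∣ < ∣ J ∣
    K<J = subst₂ _<_ (sym K≡) (sym J≡)
      (ℕₚ.≤∧≢⇒< (rank-mono (p⊆p∪q ⁅ x ⁆)) λ e → x∉X (flat x (sym e)))
  ... | y , y∈J , y∉K , ind′ with x∈p∪⁅y⁆⁻ X x (J⊆ y∈J)
  ...   | inj₁ y∈X = contradiction ind′
            (rank<⇒¬Indep (≤-reflexive (trans (cong suc (sym K≡)) (sym (∣p∪⁅x⁆∣≡1+∣p∣ K y∉K)))) (p∪⁅x⁆⊆q K⊆X y∈X))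
  ...   | inj₂ refl = hereditary (∪-monoˡ-⊆ ⁅ y ⁆ I⊆K) ind′

  cl : Subset n → Subset n
  cl X = comprehension (λ x → r (X ∪ ⁅ x ⁆) ℕ.≟ r X)

  ∈-cl⁺ : r (X ∪ ⁅ x ⁆) ≡ r X → x ∈ cl X
  ∈-cl⁺ {X} = ∈-comprehension⁺ (λ x → r (X ∪ ⁅ x ⁆) ℕ.≟ r X)

  ∈-cl⁻ : x ∈ cl X → r (X ∪ ⁅ x ⁆) ≡ r X
  ∈-cl⁻ {X = X} = ∈-comprehension⁻ (λ x → r (X ∪ ⁅ x ⁆) ℕ.≟ r X)

  X⊆cl : X ⊆ cl X
  X⊆cl x∈X = ∈-cl⁺ (cong r (⊆-antisym (p∪⁅x⁆⊆q id x∈X) (p⊆p∪q _)))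

  -- Otherwise `X ∪ ⁅ x ⁆` would have an independent subset of size `r X + 1`, while `x ∈ cl X`
  -- keeps its rank at `r X`.
  cl-dependent : I ⊆ X → ∣ I ∣ ≡ r X → x ∈ cl X → x ∉ I → ¬ Indep (I ∪ ⁅ x ⁆)
  cl-dependent {I} {X} {x} I⊆X I≡ x∈cl x∉I = rank<⇒¬Indep
    (≤-reflexive (trans (cong suc (trans (∈-cl⁻ x∈cl) (sym I≡))) (sym (∣p∪⁅x⁆∣≡1+∣p∣ I x∉I))))
    (∪-monoˡ-⊆ ⁅ x ⁆ I⊆X)

  -- If a basis of `cl X` were larger than a basis of `X`, it would augment the latter by an element
  -- of `cl X`, against `cl-dependent`.
  rank-cl : ∀ X → r (cl X) ≡ r X
  rank-cl X with basis X | basis (cl X)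
  ... | I , I⊆X , indI , I≡ | J , J⊆cl , indJ , J≡ with ∣ J ∣ ≤? ∣ I ∣
  ...   | yes J≤I = ≤-antisym (subst₂ _≤_ J≡ I≡ J≤I) (rank-mono X⊆cl)
  ...   | no J≰I with augment indI indJ (ℕₚ.≰⇒> J≰I)
  ...     | x , x∈J , x∉I , ind′ = contradiction ind′ (cl-dependent I⊆X I≡ (J⊆cl x∈J) x∉I)

  cl-flat : ∀ X → IsFlat M (cl X)
  cl-flat X x e = ∈-cl⁺ (≤-antisym
    (subst (r (X ∪ ⁅ x ⁆) ≤_) (trans e (rank-cl X)) (rank-mono (∪-monoˡ-⊆ ⁅ x ⁆ X⊆cl)))
    (rank-mono (p⊆p∪q ⁅ x ⁆)))

  -- For `x ∉ Y`, a basis of `X` extended by `x` is independent by flatness of `Y` and dependent by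
  -- `x ∈ cl X`.
  cl⊆flat : IsFlat M Y → X ⊆ Y → cl X ⊆ Y
  cl⊆flat {Y} {X} flat X⊆Y {x} x∈cl with x ∈? Y | basis X
  ... | yes x∈Y | _ = x∈Y
  ... | no x∉Y | I , I⊆X , indI , I≡ = contradiction
    (flat-augment flat indI (X⊆Y ∘ I⊆X) x∉Y) (cl-dependent I⊆X I≡ x∈cl (x∉Y ∘ X⊆Y ∘ I⊆X))

  -- The local form of cyclicity: a set is cyclic when this holds for it at each of its elements.
  -- Closure properties and decidability of cyclicity go through this form.
  Circuit∋_⊆_ : Fin n → Subset n → Set
  Circuit∋ x ⊆ X = ∃[ D ] (IsCircuit M D × x ∈ D × D ⊆ X)

  circuit∋-mono : X ⊆ Y → Circuit∋ x ⊆ X → Circuit∋ x ⊆ Y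
  circuit∋-mono X⊆Y (D , circ , x∈D , D⊆X) = D , circ , x∈D , X⊆Y ∘ D⊆X

  ¬Indep⇒circuit : ¬ Indep X → ∃[ D ] (IsCircuit M D × D ⊆ X)
  ¬Indep⇒circuit {X} = go (⊂-wellFounded X)
    where
    go : ∀ {X} → Acc _⊂_ X → ¬ Indep X → ∃[ D ] (IsCircuit M D × D ⊆ X)
    go {X} (acc rec) ¬ind with anySubset? (λ D → (D ⊂? X) ×-dec ¬? (indep? D))
    ... | yes (D , D⊂X , ¬indD) = map₂ (λ (c , ⊆D) → c , proj₁ D⊂X ∘ ⊆D) (go (rec D⊂X) ¬indD)
    ... | no ¬∃ = X , (¬ind , λ {D} D⊂X → decidable-stable (indep? D) λ ¬indD → ¬∃ (D , D⊂X , ¬indD)) , id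

  -- A circuit in `I ∪ ⁅ x ⁆` that avoided `x` would lie in the independent set `I`.
  dependent⇒circuit∋ : Indep I → ¬ Indep (I ∪ ⁅ x ⁆) → Circuit∋ x ⊆ (I ∪ ⁅ x ⁆)
  dependent⇒circuit∋ {I} {x} ind ¬ind with ¬Indep⇒circuit ¬ind
  ... | D , circ , D⊆ with x ∈? D
  ...   | yes x∈D = D , circ , x∈D , D⊆
  ...   | no x∉D = contradiction (hereditary D⊆I ind) (proj₁ circ)
    where
    D⊆I : D ⊆ I
    D⊆I y∈D with x∈p∪⁅y⁆⁻ I x (D⊆ y∈D)
    ... | inj₁ y∈I = y∈I
    ... | inj₂ refl = contradiction y∈D x∉D

  circuit-remove : ∀ {D} → IsCircuit M D → x ∈ D → Indep (D ∖ x)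
  circuit-remove (_ , ⊂⇒Indep) x∈D = ⊂⇒Indep (x∈p⇒p-x⊂p x∈D)

  rank-circuit : ∀ {D} → IsCircuit M D → r D < ∣ D ∣
  rank-circuit {D} (¬ind , _) with basis D
  ... | I , I⊆D , ind , I≡ = subst (_< ∣ D ∣) I≡
    (ℕₚ.≰⇒> λ D≤I → ¬ind (hereditary (p⊆q∧∣q∣≤∣p∣⇒q⊆p I⊆D D≤I) ind))

  cyclic⇒circuit∋ : IsCyclic M X → x ∈ X → Circuit∋ x ⊆ X
  cyclic⇒circuit∋ (Cs , circs , refl) x∈X with x∈⋃⁻ Cs x∈X
  ... | D , D∈ , x∈D = D , All.lookup circs D∈ , x∈D , x∈⋃⁺ D∈

  circuits⇒cyclic : (∀ {x} → x ∈ X → Circuit∋ x ⊆ X) → IsCyclic M X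
  circuits⇒cyclic {X} h with cover (allFin n)
    where
    -- One circuit is collected for each member of `X` in `xs`; at the end `xs` lists the whole
    -- ground set.
    cover : ∀ xs → ∃[ Cs ] (All (IsCircuit M) Cs × ⋃ Cs ⊆ X × (∀ {x} → x List.∈ xs → x ∈ X → x ∈ ⋃ Cs))
    cover [] = [] , [] , (λ x∈ → contradiction x∈ ∉⊥) , λ ()
    cover (x ∷ xs) with x ∈? X | cover xs
    ... | no x∉X | Cs , circs , ⊆X , cov =
      Cs , circs , ⊆X , λ { (here refl) x∈X → contradiction x∈X x∉X ; (there y∈) → cov y∈ }
    ... | yes x∈X | Cs , circs , ⊆X , cov with h x∈X
    ...   | D , circ , x∈D , D⊆X = D ∷ Cs , circ ∷ circs , ∪-lub D⊆X ⊆X ,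
      λ { (here refl) _ → p⊆p∪q (⋃ Cs) x∈D ; (there y∈) y∈X → q⊆p∪q D (⋃ Cs) (cov y∈ y∈X) }
  ... | Cs , circs , ⊆X , cov = Cs , circs , ⊆-antisym (cov (∈-allFin _)) ⊆X

  cyclic-⊥ : IsCyclic M ⊥
  cyclic-⊥ = [] , [] , refl

  cyclic-∪ : IsCyclic M X → IsCyclic M Y → IsCyclic M (X ∪ Y)
  cyclic-∪ {X} {Y} cX cY = circuits⇒cyclic λ x∈ → case x∈p∪q⁻ X Y x∈ of λ
    { (inj₁ h) → circuit∋-mono (p⊆p∪q Y) (cyclic⇒circuit∋ cX h)
    ; (inj₂ h) → circuit∋-mono (q⊆p∪q X Y) (cyclic⇒circuit∋ cY h) }

  cyclic-circuit : ∀ {D} → IsCircuit M D → IsCyclic M D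
  cyclic-circuit {D} circ = D ∷ [] , circ ∷ [] , sym (∪-identityʳ D)

  -- An element that the closure adds forms a dependent set with a basis of `X`, and so lies in a
  -- circuit inside `cl X`.
  cyclic-cl : IsCyclic M X → IsCyclic M (cl X)
  cyclic-cl {X} cX = circuits⇒cyclic circuit∋
    where
    circuit∋ : ∀ {x} → x ∈ cl X → Circuit∋ x ⊆ cl X
    circuit∋ {x} x∈cl with x ∈? X | basis X
    ... | yes x∈X | _ = circuit∋-mono X⊆cl (cyclic⇒circuit∋ cX x∈X)
    ... | no x∉X | I , I⊆X , ind , I≡ =
      circuit∋-mono (p∪⁅x⁆⊆q (X⊆cl ∘ I⊆X) x∈cl)
        (dependent⇒circuit∋ ind (cl-dependent I⊆X I≡ x∈cl (x∉X ∘ I⊆X)))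

  cl-cyclicFlat : IsCyclic M X → IsCyclicFlat M (cl X)
  cl-cyclicFlat {X} cX = cl-flat X , cyclic-cl cX

  -- A basis of `X` splits into its part in `Y` and its part outside. This will bound the weight of
  -- a cyclic flat by the number of elements available for it.
  rank≤rank∩+∣─∣ : ∀ X Y → r X ≤ r (X ∩ Y) ℕ.+ ∣ X ─ Y ∣
  rank≤rank∩+∣─∣ X Y with basis X
  ... | I , I⊆X , ind , I≡ = begin
    r X                       ≡⟨ I≡ ⟨
    ∣ I ∣                     ≡⟨ ∣p∣≡∣p∩q∣+∣p─q∣ I Y ⟩
    ∣ I ∩ Y ∣ ℕ.+ ∣ I ─ Y ∣     ≤⟨ ℕₚ.+-mono-≤ (Indep⇒∣I∣≤rank (hereditary (p∩q⊆p I Y) ind) I∩Y⊆)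
                                             (p⊆q⇒∣p∣≤∣q∣ I─Y⊆) ⟩
    r (X ∩ Y) ℕ.+ ∣ X ─ Y ∣     ∎
    where
    open ℕₚ.≤-Reasoning
    I∩Y⊆ : I ∩ Y ⊆ X ∩ Y
    I∩Y⊆ x∈ with x∈p∩q⁻ I Y x∈
    ... | x∈I , x∈Y = x∈p∩q⁺ (I⊆X x∈I , x∈Y)
    I─Y⊆ : I ─ Y ⊆ X ─ Y
    I─Y⊆ x∈ with x∈p─q⁻ I Y x∈
    ... | x∈I , x∉Y = x∈p∧x∉q⇒x∈p─q (I⊆X x∈I) x∉Y

  circuit? : ∀ D → Dec (IsCircuit M D)
  circuit? D = ¬? (indep? D) ×-dec map′
    (λ ¬∃ {E} E⊂D → decidable-stable (indep? E) λ ¬ind → ¬∃ (E , E⊂D , ¬ind))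
    (λ ⊂⇒Indep (E , E⊂D , ¬ind) → ¬ind (⊂⇒Indep E⊂D))
    (¬? (anySubset? (λ E → (E ⊂? D) ×-dec ¬? (indep? E))))

  -- Searching for a list of circuits has no evident bound, but searching for one circuit through
  -- each element is finite.
  cyclicFlat? : ∀ X → Dec (IsCyclicFlat M X)
  cyclicFlat? X = all? (λ x → (r (X ∪ ⁅ x ⁆) ℕ.≟ r X) →-dec (x ∈? X)) ×-dec map′
    (λ h → circuits⇒cyclic (h _)) (λ cX _ → cyclic⇒circuit∋ cX)
    (all? λ x → (x ∈? X) →-dec anySubset? λ D → circuit? D ×-dec (x ∈? D) ×-dec (D ⊆? X))

-- Integer weights on subsets of a finite index set.

weight : (Fin m → ℤ) → Subset m → ℤ
weight w [] = 0ℤ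
weight w (true ∷ P) = w zero + weight (w ∘ suc) P
weight w (false ∷ P) = weight (w ∘ suc) P

weight-cong : ∀ {w v : Fin m → ℤ} → (∀ i → w i ≡ v i) → ∀ P → weight w P ≡ weight v P
weight-cong w≡v [] = refl
weight-cong w≡v (true ∷ P) = cong₂ _+_ (w≡v zero) (weight-cong (w≡v ∘ suc) P)
weight-cong w≡v (false ∷ P) = weight-cong (w≡v ∘ suc) P

weight-⊥ : ∀ (w : Fin m → ℤ) → weight w ⊥ ≡ 0ℤ
weight-⊥ {zero} w = refl
weight-⊥ {suc m} w = weight-⊥ (w ∘ suc)

weight-∪-∩ : ∀ (w : Fin m → ℤ) P Q → weight w (P ∪ Q) + weight w (P ∩ Q) ≡ weight w P + weight w Q
weight-∪-∩ w [] [] = refl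
weight-∪-∩ w (true ∷ P) (true ∷ Q) =
  trans (interchange (w zero) _ _)
    (trans (cong (_+_ (w zero + w zero)) (weight-∪-∩ (w ∘ suc) P Q)) (sym (interchange (w zero) _ _)))
  where
  interchange : ∀ a b c → (a + b) + (a + c) ≡ (a + a) + (b + c)
  interchange = solve-∀
weight-∪-∩ w (true ∷ P) (false ∷ Q) =
  trans (ℤₚ.+-assoc (w zero) _ _)
    (trans (cong (_+_ (w zero)) (weight-∪-∩ (w ∘ suc) P Q)) (sym (ℤₚ.+-assoc (w zero) _ _)))
weight-∪-∩ w (false ∷ P) (true ∷ Q) =
  trans (ℤₚ.+-assoc (w zero) _ _)
    (trans (cong (_+_ (w zero)) (weight-∪-∩ (w ∘ suc) P Q)) (swap (w zero) (weight (w ∘ suc) P) _))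
  where
  swap : ∀ a b c → a + (b + c) ≡ b + (a + c)
  swap = solve-∀
weight-∪-∩ w (false ∷ P) (false ∷ Q) = weight-∪-∩ (w ∘ suc) P Q

weight-∪-disjoint : ∀ (w : Fin m → ℤ) {P Q} → (∀ {i} → i ∈ P → i ∉ Q) →
  weight w (P ∪ Q) ≡ weight w P + weight w Q
weight-∪-disjoint w {P} {Q} disj = begin
  weight w (P ∪ Q)                    ≡⟨ ℤₚ.+-identityʳ _ ⟨
  weight w (P ∪ Q) + 0ℤ               ≡⟨ cong (_+_ (weight w (P ∪ Q))) (weight-⊥ w) ⟨
  weight w (P ∪ Q) + weight w ⊥       ≡⟨ cong (λ R → weight w (P ∪ Q) + weight w R) P∩Q≡⊥ ⟨
  weight w (P ∪ Q) + weight w (P ∩ Q) ≡⟨ weight-∪-∩ w P Q ⟩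
  weight w P + weight w Q             ∎
  where
  open ≡-Reasoning
  P∩Q≡⊥ : P ∩ Q ≡ ⊥
  P∩Q≡⊥ = Empty-unique λ (i , i∈) → let i∈P , i∈Q = x∈p∩q⁻ P Q i∈ in disj i∈P i∈Q

weight-⁅⁆ : ∀ (w : Fin m → ℤ) i → weight w ⁅ i ⁆ ≡ w i
weight-⁅⁆ w zero = trans (cong (_+_ (w zero)) (weight-⊥ (w ∘ suc))) (ℤₚ.+-identityʳ _)
weight-⁅⁆ w (suc i) = weight-⁅⁆ (w ∘ suc) i

weight-1 : ∀ (P : Subset m) → weight (λ _ → 1ℤ) P ≡ + ∣ P ∣
weight-1 [] = refl
weight-1 (true ∷ P) = cong (_+_ 1ℤ) (weight-1 P)
weight-1 (false ∷ P) = weight-1 P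

⋃ᵢ : (Fin m → Subset n) → Subset m → Subset n
⋃ᵢ B [] = ⊥
⋃ᵢ B (true ∷ P) = B zero ∪ ⋃ᵢ (B ∘ suc) P
⋃ᵢ B (false ∷ P) = ⋃ᵢ (B ∘ suc) P

x∈⋃ᵢ⁺ : ∀ (B : Fin m → Subset n) {P i x} → i ∈ P → x ∈ B i → x ∈ ⋃ᵢ B P
x∈⋃ᵢ⁺ B here x∈ = x∈p∪q⁺ (inj₁ x∈)
x∈⋃ᵢ⁺ B {true ∷ P} (there i∈P) x∈ = q⊆p∪q (B zero) _ (x∈⋃ᵢ⁺ (B ∘ suc) i∈P x∈)
x∈⋃ᵢ⁺ B {false ∷ P} (there i∈P) x∈ = x∈⋃ᵢ⁺ (B ∘ suc) i∈P x∈

x∈⋃ᵢ⁻ : ∀ (B : Fin m → Subset n) P {x} → x ∈ ⋃ᵢ B P → ∃[ i ] (i ∈ P × x ∈ B i)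
x∈⋃ᵢ⁻ B [] x∈ = contradiction x∈ ∉⊥
x∈⋃ᵢ⁻ B (true ∷ P) x∈ with x∈p∪q⁻ (B zero) _ x∈
... | inj₁ h = zero , here , h
... | inj₂ h with x∈⋃ᵢ⁻ (B ∘ suc) P h
...   | i , i∈P , x∈B = suc i , there i∈P , x∈B
x∈⋃ᵢ⁻ B (false ∷ P) x∈ with x∈⋃ᵢ⁻ (B ∘ suc) P x∈
... | i , i∈P , x∈B = suc i , there i∈P , x∈B

∣⋃ᵢ∣ : ∀ (B : Fin m → Subset n) → (∀ {i j x} → x ∈ B i → x ∈ B j → i ≡ j) →
  ∀ P → + ∣ ⋃ᵢ B P ∣ ≡ weight (λ i → + ∣ B i ∣) P
∣⋃ᵢ∣ {n = n} B disj [] = cong +_ (∣⊥∣≡0 n)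
∣⋃ᵢ∣ B disj (true ∷ P) = trans
  (cong +_ (∣p∪q∣≡∣p∣+∣q∣ (B zero) (⋃ᵢ (B ∘ suc) P) B₀-disjoint))
  (cong (_+_ (+ ∣ B zero ∣)) (∣⋃ᵢ∣ (B ∘ suc) (λ a b → suc-injective (disj a b)) P))
  where
  B₀-disjoint : ∀ {x} → x ∈ B zero → x ∉ ⋃ᵢ (B ∘ suc) P
  B₀-disjoint x∈B₀ x∈ with x∈⋃ᵢ⁻ (B ∘ suc) P x∈
  ... | i , _ , x∈B with disj x∈B₀ x∈B
  ...   | ()
∣⋃ᵢ∣ B disj (false ∷ P) = ∣⋃ᵢ∣ (B ∘ suc) (λ a b → suc-injective (disj a b)) P

-- Equation `j` involves only unknowns `w i` with `i ≥ j`, and `w j` has coefficient 1, so back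
-- substitution stays within the integers. The recursion solves all equations but the first, which
-- alone contains `w zero`.
triangular-system : ∀ {m} (a : Fin m → Subset m) (h : Fin m → ℤ) →
  (∀ i → i ∈ a i) → (∀ {i j} → i Fin.< j → i ∉ a j) →
  ∃[ w ] (∀ j → weight w (a j) ≡ h j)
triangular-system {zero} a h diag tri = (λ ()) , λ ()
triangular-system {suc m} a h diag tri
  with triangular-system (tail ∘ a ∘ suc) (h ∘ suc)
         (λ i → ∈-tail (a (suc i)) (diag (suc i)))
         (λ {i} {j} i<j i∈ → tri (s≤s i<j) (∈-tail⁻ (a (suc j)) i∈))
  where
  ∈-tail : ∀ {m i} (P : Subset (suc m)) → suc i ∈ P → i ∈ tail P
  ∈-tail _ (there i∈) = i∈
  ∈-tail⁻ : ∀ {m i} (P : Subset (suc m)) → i ∈ tail P → suc i ∈ P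
  ∈-tail⁻ (_ ∷ _) = there
... | v , v-solves = w , w-solves
  where
  open ≡-Reasoning
  w : Fin (suc m) → ℤ
  w zero = h zero - weight v (tail (a zero))
  w (suc i) = v i
  weight-∈ : ∀ P → zero ∈ P → weight w P ≡ w zero + weight v (tail P)
  weight-∈ (true ∷ P) here = refl
  weight-∉ : ∀ P → zero ∉ P → weight w P ≡ weight v (tail P)
  weight-∉ (true ∷ P) 0∉ = contradiction here 0∉
  weight-∉ (false ∷ P) _ = refl
  cancel : ∀ x y → x - y + y ≡ x
  cancel = solve-∀
  w-solves : ∀ j → weight w (a j) ≡ h j
  w-solves zero = trans (weight-∈ (a zero) (diag zero)) (cancel (h zero) _)
  w-solves (suc j) = trans (weight-∉ (a (suc j)) (tri (s≤s z≤n))) (v-solves j)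

-- Alternating sums over subfamilies and inclusion-exclusion.

alternatingSum : (Subset n → ℤ) → List (Subset n) → ℤ
alternatingSum k F =
  foldr _+_ 0ℤ (map (λ F′ → (-1ℤ ^ suc (length F′)) * k (⋃ F′)) (sublists F))

foldr-+-++ : ∀ xs ys → foldr _+_ 0ℤ (xs ++ ys) ≡ foldr _+_ 0ℤ xs + foldr _+_ 0ℤ ys
foldr-+-++ [] ys = sym (ℤₚ.+-identityˡ _)
foldr-+-++ (x ∷ xs) ys = trans (cong (_+_ x) (foldr-+-++ xs ys)) (sym (ℤₚ.+-assoc x _ _))

foldr-+-neg : ∀ {A : Set} (f : A → ℤ) xs →
  foldr _+_ 0ℤ (map (-_ ∘ f) xs) ≡ - foldr _+_ 0ℤ (map f xs)
foldr-+-neg f [] = refl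
foldr-+-neg f (x ∷ xs) = trans (cong (_+_ (- f x)) (foldr-+-neg f xs)) (sym (ℤₚ.neg-distrib-+ (f x) _))

alternatingSum-[] : ∀ (k : Subset n → ℤ) → alternatingSum k [] ≡ - k ⊥
alternatingSum-[] k = trans (ℤₚ.+-identityʳ _) (ℤₚ.-1*i≡-i (k ⊥))

-- Subfamilies are sorted by whether they use `X`; using it flips the sign and joins `X` to the
-- union. This is why `k` is arbitrary: the recursion replaces it by `k ∘ (X ∪_)`.
alternatingSum-∷ : ∀ (k : Subset n → ℤ) X F →
  alternatingSum k (X ∷ F) ≡ alternatingSum k F - alternatingSum (k ∘ (X ∪_)) F
alternatingSum-∷ k X F = begin
  Σ (map t (sublists F ++ map (X ∷_) (sublists F)))           ≡⟨ cong Σ (map-++ t (sublists F) _) ⟩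
  Σ (map t (sublists F) ++ map t (map (X ∷_) (sublists F)))   ≡⟨ foldr-+-++ (map t (sublists F)) _ ⟩
  alternatingSum k F + Σ (map t (map (X ∷_) (sublists F)))    ≡⟨ cong (λ l → alternatingSum k F + Σ l)
                                                                   (trans (sym (map-∘ (sublists F)))
                                                                     (map-cong sign-flip (sublists F))) ⟩
  alternatingSum k F + Σ (map (-_ ∘ t′) (sublists F))         ≡⟨ cong (_+_ (alternatingSum k F)) (foldr-+-neg t′ (sublists F)) ⟩
  alternatingSum k F - alternatingSum (k ∘ (X ∪_)) F          ∎
  where
  open ≡-Reasoning
  Σ = foldr _+_ 0ℤ
  t t′ : List (Subset _) → ℤ
  t F′ = (-1ℤ ^ suc (length F′)) * k (⋃ F′)
  t′ F′ = (-1ℤ ^ suc (length F′)) * k (X ∪ ⋃ F′)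
  sign-flip : ∀ F′ → t (X ∷ F′) ≡ - t′ F′
  sign-flip F′ = trans
    (ℤₚ.*-assoc -1ℤ (-1ℤ ^ suc (length F′)) (k (X ∪ ⋃ F′))) (ℤₚ.-1*i≡-i (t′ F′))

-- Only unions of members of `F` are evaluated. Rank agrees with a weight on a restricted class of
-- sets only, and closure of `C` under unions lets the hypothesis survive the passage from `k` to
-- `k ∘ (X ∪_)`.
alternatingSum-cong : ∀ {k k′ : Subset n → ℤ} (C : Subset n → Set) →
  C ⊥ → (∀ {X Y} → C X → C Y → C (X ∪ Y)) → (∀ {X} → C X → k X ≡ k′ X) →
  ∀ {F} → All C F → alternatingSum k F ≡ alternatingSum k′ F
alternatingSum-cong {k = k} {k′} C C⊥ C∪ k≡k′ [] =
  trans (alternatingSum-[] k) (trans (cong -_ (k≡k′ C⊥)) (sym (alternatingSum-[] k′)))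
alternatingSum-cong {k = k} {k′} C C⊥ C∪ k≡k′ {X ∷ F} (CX ∷ CF) = trans (alternatingSum-∷ k X F)
  (trans (cong₂ _-_ (alternatingSum-cong C C⊥ C∪ k≡k′ CF)
                    (alternatingSum-cong C C⊥ C∪ (λ CY → k≡k′ (C∪ CX CY)) CF))
         (sym (alternatingSum-∷ k′ X F)))

-- Used twice: for necessity `N Y` holds the `i` with `b i ∈ Y`, for sufficiency the cyclic flats
-- not containing `Y`. The result is stated with `⋂ (map N F)` because `N` is only assumed to
-- respect unions.
module _ (N : Subset n → Subset m) (N-⊥ : N ⊥ ≡ ⊥) (N-∪ : ∀ X Y → N (X ∪ Y) ≡ N X ∪ N Y)
         (w : Fin m → ℤ) where

  private
    μ = weight w

  -- Relative to a base set U, so that the induction on the family goes through.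
  inclusion-exclusion-over : ∀ U X F → alternatingSum (λ Y → μ (U ∪ N Y)) (X ∷ F)
                           ≡ μ (U ∪ ⋂ (map N (X ∷ F))) - μ U
  inclusion-exclusion-over U X [] = begin
    alternatingSum k (X ∷ [])                               ≡⟨ alternatingSum-∷ k X [] ⟩
    alternatingSum k [] - alternatingSum (k ∘ (X ∪_)) []    ≡⟨ cong₂ _-_ (alternatingSum-[] k) (alternatingSum-[] (k ∘ (X ∪_))) ⟩
    - k ⊥ - - k (X ∪ ⊥)                                     ≡⟨ cong₂ (λ a b → - a - - b)
                                                                 (cong μ (trans (cong (U ∪_) N-⊥) (∪-identityʳ U)))
                                                                 (cong k (∪-identityʳ X)) ⟩
    - μ U - - μ (U ∪ N X)                                   ≡⟨ flip (μ U) _ ⟩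
    μ (U ∪ N X) - μ U                                       ≡⟨ cong (λ P → μ (U ∪ P) - μ U) (∩-identityʳ (N X)) ⟨
    μ (U ∪ N X ∩ ⊤) - μ U                                   ∎
    where
    open ≡-Reasoning
    k = λ Y → μ (U ∪ N Y)
    flip : ∀ a b → - a - - b ≡ b - a
    flip = solve-∀
  inclusion-exclusion-over U X (Y ∷ F) = begin
    alternatingSum k (X ∷ Y ∷ F)
      ≡⟨ alternatingSum-∷ k X (Y ∷ F) ⟩
    alternatingSum k (Y ∷ F) - alternatingSum (k ∘ (X ∪_)) (Y ∷ F)
      ≡⟨ cong₂ _-_ (inclusion-exclusion-over U Y F)
           (trans (alternatingSum-cong (λ _ → Unit.⊤) _ _ (λ {Z} _ → cong μ (regroup Z)) (All.universal _ (Y ∷ F)))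
                  (inclusion-exclusion-over (U ∪ N X) Y F)) ⟩
    (μ (U ∪ R) - μ U) - (μ ((U ∪ N X) ∪ R) - μ (U ∪ N X))
      -- Absorbing a second copy of `U` exhibits the union of `U ∪ N X` and `U ∪ R`, to which the
      -- modular law `weight-∪-∩` applies.
      ≡⟨ cong (λ P → (μ (U ∪ R) - μ U) - (μ P - μ (U ∪ N X))) union ⟩
    (μ (U ∪ R) - μ U) - (μ ((U ∪ N X) ∪ (U ∪ R)) - μ (U ∪ N X))
      ≡⟨ rearrange (μ (U ∪ R)) (μ U) (μ (U ∪ N X)) (μ ((U ∪ N X) ∪ (U ∪ R)))
           (μ ((U ∪ N X) ∩ (U ∪ R))) (weight-∪-∩ w (U ∪ N X) (U ∪ R)) ⟩
    μ ((U ∪ N X) ∩ (U ∪ R)) - μ U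
      ≡⟨ cong (λ P → μ P - μ U) (∪-distribˡ-∩ U (N X) R) ⟨
    μ (U ∪ N X ∩ R) - μ U
      ∎
    where
    open ≡-Reasoning
    k = λ Z → μ (U ∪ N Z)
    R = ⋂ (map N (Y ∷ F))
    regroup : ∀ Z → U ∪ N (X ∪ Z) ≡ (U ∪ N X) ∪ N Z
    regroup Z = trans (cong (U ∪_) (N-∪ X Z)) (sym (∪-assoc U (N X) (N Z)))
    union : (U ∪ N X) ∪ R ≡ (U ∪ N X) ∪ (U ∪ R)
    union = ⊆-antisym
      (∪-lub (p⊆p∪q _) (q⊆p∪q (U ∪ N X) _ ∘ q⊆p∪q U R))
      (∪-lub (p⊆p∪q _) (∪-lub (p⊆p∪q R ∘ p⊆p∪q (N X)) (q⊆p∪q (U ∪ N X) R)))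
    rearrange : ∀ b u v c d → c + d ≡ v + b → (b - u) - (c - v) ≡ d - u
    rearrange b u v c d e = begin
      (b - u) - (c - v)            ≡⟨ step₁ b u v c d ⟩
      (v + b) - (c + d) + (d - u)  ≡⟨ cong (λ z → (v + b) - z + (d - u)) e ⟩
      (v + b) - (v + b) + (d - u)  ≡⟨ step₂ (v + b) (d - u) ⟩
      d - u                        ∎
      where
      step₁ : ∀ b u v c d → (b - u) - (c - v) ≡ (v + b) - (c + d) + (d - u)
      step₁ = solve-∀
      step₂ : ∀ x y → x - x + y ≡ y
      step₂ = solve-∀

  inclusion-exclusion : ∀ {F} → F ≢ [] → alternatingSum (μ ∘ N) F ≡ μ (⋂ (map N F))
  inclusion-exclusion {[]} F≢[] = contradiction refl F≢[]
  inclusion-exclusion {X ∷ F} _ = begin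
    alternatingSum (μ ∘ N) (X ∷ F)                ≡⟨ alternatingSum-cong (λ _ → Unit.⊤) _ _
                                                       (λ {Z} _ → cong μ (sym (∪-identityˡ (N Z)))) (All.universal _ (X ∷ F)) ⟩
    alternatingSum (λ Y → μ (⊥ ∪ N Y)) (X ∷ F)    ≡⟨ inclusion-exclusion-over ⊥ X F ⟩
    μ (⊥ ∪ ⋂ (map N (X ∷ F))) - μ ⊥               ≡⟨ cong₂ _-_ (cong μ (∪-identityˡ _)) (weight-⊥ w) ⟩
    μ (⋂ (map N (X ∷ F))) - 0ℤ                    ≡⟨ ℤₚ.+-identityʳ _ ⟩
    μ (⋂ (map N (X ∷ F)))                         ∎
    where
    open ≡-Reasoning

-- Partial transversals as matchings.

module _ {n s : ℕ} (A : Fin s → Subset n) where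

  -- A curried partial transversal, whose injectivity compares elements without their membership
  -- proofs.
  record Matching (I : Subset n) : Set where
    field
      to        : ∀ x → x ∈ I → Fin s
      to-∈      : ∀ x x∈I → x ∈ A (to x x∈I)
      injective : ∀ x y x∈I y∈I → to x x∈I ≡ to y y∈I → x ≡ y

  open Matching

  matching⇒partialTransversal : ∀ {I} → Matching I → IsPartialTransversal A I
  matching⇒partialTransversal φ =
    mk↣ {to = λ (x , x∈I) → to φ x x∈I}
        (λ {(x , x∈I)} {(y , y∈I)} e → pair-≡ (injective φ x y x∈I y∈I e)) ,
    λ (x , x∈I) → to-∈ φ x x∈I
    where
    pair-≡ : ∀ {I : Subset n} {x y} {x∈I : x ∈ I} {y∈I : y ∈ I} → x ≡ y → (x , x∈I) ≡ (y , y∈I)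
    pair-≡ refl = cong (_ ,_) ([]=-irrelevant _ _)

  partialTransversal⇒matching : ∀ {I} → IsPartialTransversal A I → Matching I
  partialTransversal⇒matching (φ , φ∈A) = record
    { to = λ x x∈I → Injection.to φ (x , x∈I)
    ; to-∈ = λ x x∈I → φ∈A (x , x∈I)
    ; injective = λ x y x∈I y∈I e → cong proj₁ (Injection.injective φ e)
    }

  -- Since `x` lies in every `A j` that contains `b`, it can take over the index matched to `b`.
  matching-replace : ∀ {I x b} → b ∉ I ∖ x → (∀ j → b ∈ A j → x ∈ A j) →
    Matching ((I ∖ x) ∪ ⁅ b ⁆) → Matching I
  matching-replace {I} {x} {b} b∉ b⇒x φ = record { to = to′ ; to-∈ = to′-∈ ; injective = inj′ }
    where
    b∈ = x∈p∪⁅x⁆ (I ∖ x) b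
    keep : ∀ {y} → y ∈ I → y ≢ x → y ∈ (I ∖ x) ∪ ⁅ b ⁆
    keep y∈I y≢x = p⊆p∪q ⁅ b ⁆ (x∈p∧x≢y⇒x∈p-y y∈I y≢x)
    to′ : ∀ y → y ∈ I → Fin s
    to′ y y∈I with y Fin.≟ x
    ... | yes _ = to φ b b∈
    ... | no y≢x = to φ y (keep y∈I y≢x)
    to′-∈ : ∀ y y∈I → y ∈ A (to′ y y∈I)
    to′-∈ y y∈I with y Fin.≟ x
    ... | yes refl = b⇒x _ (to-∈ φ b b∈)
    ... | no y≢x = to-∈ φ y (keep y∈I y≢x)
    inj′ : ∀ y z y∈I z∈I → to′ y y∈I ≡ to′ z z∈I → y ≡ z
    inj′ y z y∈I z∈I e with y Fin.≟ x | z Fin.≟ x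
    ... | yes refl | yes refl = refl
    -- A collision would give `b ≡ z`, but `z` lies in `I ∖ x` and `b` does not.
    ... | yes _ | no z≢x = contradiction
      (subst (_∈ I ∖ x) (sym (injective φ _ _ _ _ e)) (x∈p∧x≢y⇒x∈p-y z∈I z≢x)) b∉
    ... | no y≢x | yes _ = contradiction
      (subst (_∈ I ∖ x) (injective φ _ _ _ _ e) (x∈p∧x≢y⇒x∈p-y y∈I y≢x)) b∉
    ... | no _ | no _ = injective φ _ _ _ _ e

  x∈⋃-others⁺ : ∀ {x i j} → j ≢ i → x ∈ A j → x ∈ ⋃-others A i
  x∈⋃-others⁺ {i = i} {j} j≢i =
    x∈⋃⁺ (∈-map⁺ A (∈-filter⁺ (λ j → ¬? (j Fin.≟ i)) (∈-allFin j) j≢i))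

  x∈⋃-others⁻ : ∀ {x} i → x ∈ ⋃-others A i → ∃[ j ] (j ≢ i × x ∈ A j)
  x∈⋃-others⁻ i x∈ with x∈⋃⁻ _ x∈
  ... | X , X∈ , x∈X with ∈-map⁻ A X∈
  ...   | j , j∈ , refl = j , proj₂ (∈-filter⁻ (λ j → ¬? (j Fin.≟ i)) {xs = allFin s} j∈) , x∈X

-- Necessity: ranks in a fundamental presentation.

module FundamentalPresentation {n s : ℕ} (M : Matroid n) (A : Fin s → Subset n)
  (presentation : IsPresentation M A) (private-element : ∀ i → Nonempty (A i ─ ⋃-others A i)) where

  open Matroid M
  open MatroidTheory M
  open Matching

  b : Fin s → Fin n
  b i = proj₁ (private-element i)

  b∈A : ∀ i → b i ∈ A i
  b∈A i = p─q⊆p (A i) (⋃-others A i) (proj₂ (private-element i))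

  b∈A⇒≡ : ∀ {i j} → b i ∈ A j → j ≡ i
  b∈A⇒≡ {i} {j} b∈ with j Fin.≟ i
  ... | yes e = e
  ... | no j≢i = contradiction (x∈⋃-others⁺ A j≢i b∈)
                   (proj₂ (x∈p─q⁻ (A i) (⋃-others A i) (proj₂ (private-element i))))

  b-injective : ∀ {i j} → b i ≡ b j → i ≡ j
  b-injective {i} {j} e = b∈A⇒≡ (subst (_∈ A i) e (b∈A i))

  Indep⇒matching : ∀ {I} → Indep I → Matching A I
  Indep⇒matching {I} ind = partialTransversal⇒matching A (Equivalence.to (presentation I) ind)

  matching⇒Indep : ∀ {I} → Matching A I → Indep I
  matching⇒Indep {I} φ = Equivalence.from (presentation I) (matching⇒partialTransversal A φ)

  -- What is kept of cyclic flats. It passes to unions and to intersections, so one rank formula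
  -- serves both sides of the equality.
  Closed : Subset n → Set
  Closed Y = ∀ {x i} → x ∈ Y → x ∈ A i → b i ∈ Y

  -- Otherwise b i could replace x in a circuit D ∋ x; but b i can only be matched
  -- to i, so x could take its place, and D would be independent.
  cyclicFlat⇒closed : ∀ {X} → IsCyclicFlat M X → Closed X
  cyclicFlat⇒closed {X} (flat , cX) {x} {i} x∈X x∈A with b i ∈? X
  ... | yes b∈X = b∈X
  ... | no b∉X with cyclic⇒circuit∋ cX x∈X
  ...   | D , circ , x∈D , D⊆X = contradiction
    (matching⇒Indep (matching-replace A (b∉X ∘ D-x⊆X) (λ j b∈A → subst (λ j → x ∈ A j) (sym (b∈A⇒≡ b∈A)) x∈A)
      (Indep⇒matching (flat-augment flat (circuit-remove circ x∈D) D-x⊆X b∉X))))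
    (proj₁ circ)
    where
    D-x⊆X : D ∖ x ⊆ X
    D-x⊆X = D⊆X ∘ p─q⊆p D ⁅ x ⁆

  N : Subset n → Subset s
  N Y = comprehension (λ i → b i ∈? Y)

  ∈N⁺ : ∀ {Y i} → b i ∈ Y → i ∈ N Y
  ∈N⁺ {Y} = ∈-comprehension⁺ (λ i → b i ∈? Y)

  ∈N⁻ : ∀ {Y i} → i ∈ N Y → b i ∈ Y
  ∈N⁻ {Y} = ∈-comprehension⁻ (λ i → b i ∈? Y)

  N-⊥ : N ⊥ ≡ ⊥
  N-⊥ = Empty-unique λ (i , i∈) → ∉⊥ (∈N⁻ i∈)

  N-∪ : ∀ X Y → N (X ∪ Y) ≡ N X ∪ N Y
  N-∪ X Y = ⊆-antisym
    (λ i∈ → case x∈p∪q⁻ X Y (∈N⁻ i∈) of λ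
      { (inj₁ h) → p⊆p∪q (N Y) (∈N⁺ h) ; (inj₂ h) → q⊆p∪q (N X) (N Y) (∈N⁺ h) })
    (∪-lub (λ i∈ → ∈N⁺ (p⊆p∪q Y (∈N⁻ i∈))) (λ i∈ → ∈N⁺ (q⊆p∪q X Y (∈N⁻ i∈))))

  N-⋂ : ∀ F → N (⋂ F) ≡ ⋂ (map N F)
  N-⋂ [] = ⊆-antisym ⊆⊤ (λ _ → ∈N⁺ ∈⊤)
  N-⋂ (X ∷ F) = trans
    (⊆-antisym (λ i∈ → let b∈X , b∈⋂F = x∈p∩q⁻ X (⋂ F) (∈N⁻ i∈) in x∈p∩q⁺ (∈N⁺ b∈X , ∈N⁺ b∈⋂F))
               (λ i∈ → let i∈X , i∈F = x∈p∩q⁻ (N X) (N (⋂ F)) i∈ in ∈N⁺ (x∈p∩q⁺ (∈N⁻ i∈X , ∈N⁻ i∈F))))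
    (cong (N X ∩_) (N-⋂ F))

  closed-∪ : ∀ {X Y} → Closed X → Closed Y → Closed (X ∪ Y)
  closed-∪ {X} {Y} cX cY x∈ x∈A with x∈p∪q⁻ X Y x∈
  ... | inj₁ h = p⊆p∪q Y (cX h x∈A)
  ... | inj₂ h = q⊆p∪q X Y (cY h x∈A)

  closed-⋂ : ∀ {F} → All Closed F → Closed (⋂ F)
  closed-⋂ cF x∈ x∈A = x∈⋂⁺ _ λ X∈ → All.lookup cF X∈ (⋂⊆ X∈ x∈) x∈A

  -- A matching of an independent subset of `Y` uses only indices in `N Y`, by closedness.
  -- Conversely the elements `b i` in `Y` form an independent set, each being matched to its own
  -- index.
  closed⇒rank≡∣N∣ : ∀ {Y} → Closed Y → rank M Y ≡ ∣ N Y ∣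
  closed⇒rank≡∣N∣ {Y} cY = ≤-antisym rank≤ rank≥
    where
    rank≤ : rank M Y ≤ ∣ N Y ∣
    rank≤ with basis Y
    ... | I , I⊆Y , ind , I≡ = subst (_≤ _) I≡ (∣∣-injective I (N Y) (to φ)
      (λ x x∈I → ∈N⁺ (cY (I⊆Y x∈I) (to-∈ φ x x∈I))) (injective φ))
      where φ = Indep⇒matching ind
    D? = λ x → (x ∈? Y) ×-dec Fin.any? (λ i → b i Fin.≟ x)
    D = comprehension D?
    ∈D⁻ : ∀ {x} → x ∈ D → x ∈ Y × ∃[ i ] b i ≡ x
    ∈D⁻ = ∈-comprehension⁻ D?
    ind : Indep D
    ind = matching⇒Indep record
      { to = λ x x∈D → proj₁ (proj₂ (∈D⁻ x∈D))
      ; to-∈ = λ x x∈D → let _ , i , e = ∈D⁻ x∈D in subst (_∈ A i) e (b∈A i)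
      ; injective = λ x y x∈D y∈D e →
          trans (sym (proj₂ (proj₂ (∈D⁻ x∈D)))) (trans (cong b e) (proj₂ (proj₂ (∈D⁻ y∈D))))
      }
    rank≥ : ∣ N Y ∣ ≤ rank M Y
    rank≥ = ≤-trans
      (∣∣-injective (N Y) D (λ i _ → b i) (λ i i∈ → ∈-comprehension⁺ D? (∈N⁻ i∈ , i , refl)) (λ _ _ _ _ → b-injective))
      (Indep⇒∣I∣≤rank ind (proj₁ ∘ ∈D⁻))

  rank-equality : ∀ F → IsSetOfCyclicFlats M F → F ≢ [] → RankEquality M F
  rank-equality F (_ , cyclicFlats) F≢[] = begin
    + rank M (⋂ F)                                 ≡⟨ rank≡ (closed-⋂ closed) ⟩
    weight (λ _ → 1ℤ) (N (⋂ F))                    ≡⟨ cong (weight (λ _ → 1ℤ)) (N-⋂ F) ⟩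
    weight (λ _ → 1ℤ) (⋂ (map N F))                ≡⟨ inclusion-exclusion N N-⊥ N-∪ (λ _ → 1ℤ) F≢[] ⟨
    alternatingSum (weight (λ _ → 1ℤ) ∘ N) F       ≡⟨ alternatingSum-cong Closed (λ x∈⊥ → contradiction x∈⊥ ∉⊥)
                                                        closed-∪ rank≡ closed ⟨
    alternatingRankSum M F                         ∎
    where
    open ≡-Reasoning
    closed : All Closed F
    closed = All.map (λ cf {x} {i} → cyclicFlat⇒closed cf {x} {i}) cyclicFlats
    rank≡ : ∀ {Y} → Closed Y → + rank M Y ≡ weight (λ _ → 1ℤ) (N Y)
    rank≡ {Y} cY = trans (cong +_ (closed⇒rank≡∣N∣ cY)) (sym (weight-1 (N Y)))

-- From a fundamental basis to a presentation.

module FundamentalBasis {n : ℕ} (M : Matroid n) (B : Subset n) (indB : Matroid.Indep M B)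
  (∣B∣≥ : rank M ⊤ ≤ ∣ B ∣) (∣B∩X∣≥ : ∀ {X} → IsCyclicFlat M X → rank M X ≤ ∣ B ∩ X ∣) where

  open Matroid M
  open MatroidTheory M
  open Matching

  b : Fin ∣ B ∣ → Fin n
  b = nth B

  InA? = λ i x → ¬? (x ∈? (B ∖ b i)) ×-dec indep? ((B ∖ b i) ∪ ⁅ x ⁆)

  -- The elements whose fundamental circuit with respect to B contains b i.
  A : Fin ∣ B ∣ → Subset n
  A i = comprehension (InA? i)

  ∈A⁺ : ∀ {x i} → x ∉ B ∖ b i → Indep ((B ∖ b i) ∪ ⁅ x ⁆) → x ∈ A i
  ∈A⁺ {i = i} x∉ ind = ∈-comprehension⁺ (InA? i) (x∉ , ind)

  ∈A⁻ : ∀ {x i} → x ∈ A i → x ∉ B ∖ b i × Indep ((B ∖ b i) ∪ ⁅ x ⁆)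
  ∈A⁻ {i = i} = ∈-comprehension⁻ (InA? i)

  b∈A : ∀ i → b i ∈ A i
  b∈A i = ∈A⁺ (x∉p-x B (b i)) (hereditary (p∪⁅x⁆⊆q (p─q⊆p B ⁅ b i ⁆) (nth-∈ B i)) indB)

  b∈A⇒≡ : ∀ {i j} → b i ∈ A j → j ≡ i
  b∈A⇒≡ {i} {j} b∈ with b i Fin.≟ b j
  ... | yes e = sym (nth-injective B e)
  ... | no bi≢bj = contradiction (x∈p∧x≢y⇒x∈p-y (nth-∈ B i) bi≢bj) (proj₁ (∈A⁻ b∈))

  -- If `b i ∉ X`, then `B ∩ X` lies in `B ∖ b i`, so adding `x` keeps it independent. This gives
  -- more than `rank M X` independent elements in `X`.
  cyclicFlat-closed : ∀ {X x i} → IsCyclicFlat M X → x ∈ X → x ∈ A i → b i ∈ X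
  cyclicFlat-closed {X} {x} {i} cf x∈X x∈A with b i ∈? X
  ... | yes b∈X = b∈X
  ... | no b∉X = contradiction (hereditary (∪-monoˡ-⊆ ⁅ x ⁆ B∩X⊆) (proj₂ (∈A⁻ x∈A)))
    (rank<⇒¬Indep (subst (rank M X <_) (sym (∣p∪⁅x⁆∣≡1+∣p∣ (B ∩ X) (proj₁ (∈A⁻ x∈A) ∘ B∩X⊆))) (s≤s (∣B∩X∣≥ cf)))
      (p∪⁅x⁆⊆q (p∩q⊆q B X) x∈X))
    where
    B∩X⊆ : B ∩ X ⊆ B ∖ b i
    B∩X⊆ y∈ with x∈p∩q⁻ B X y∈
    ... | y∈B , y∈X = x∈p∧x≢y⇒x∈p-y y∈B λ { refl → b∉X y∈X }

  -- A circuit `C ⊆ I` would be matched injectively into `B ∩ cl C`, an independent set of size at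
  -- most the rank of `C`, which is below `∣ C ∣`. Passing to `cl C` supplies the cyclic flat that
  -- `cyclicFlat-closed` asks for.
  matching⇒Indep : ∀ {I} → Matching A I → Indep I
  matching⇒Indep {I} φ = decidable-stable (indep? I) λ ¬ind → case ¬Indep⇒circuit ¬ind of λ (C , circ , C⊆I) →
    let cf = cl-cyclicFlat (cyclic-circuit circ) in
    ℕₚ.<⇒≱ (rank-circuit circ) (begin
      ∣ C ∣           ≤⟨ ∣∣-injective C (B ∩ cl C) (λ x x∈C → b (to φ x (C⊆I x∈C)))
                           (λ x x∈C → x∈p∩q⁺ (nth-∈ B _ , cyclicFlat-closed cf (X⊆cl x∈C) (to-∈ φ x _)))
                           (λ x y p q e → injective φ x y _ _ (nth-injective B e)) ⟩
      ∣ B ∩ cl C ∣    ≤⟨ Indep⇒∣I∣≤rank (hereditary (p∩q⊆p B (cl C)) indB) (p∩q⊆q B (cl C)) ⟩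
      rank M (cl C)   ≡⟨ rank-cl C ⟩
      rank M C        ∎)
    where open ℕₚ.≤-Reasoning

  -- Let `D` be the fundamental circuit of `x` with respect to `B`. Some `y` in `D ∖ x` lies outside
  -- `cl (I ∖ x)`; it can replace `x` in `I`, and `x` can replace it in `B`.
  symmetric-exchange : ∀ {I x} → Indep I → x ∈ I → x ∉ B →
    ∃[ i ] (x ∈ A i × b i ∉ I ∖ x × Indep ((I ∖ x) ∪ ⁅ b i ⁆))
  symmetric-exchange {I} {x} ind x∈I x∉B
    with dependent⇒circuit∋ indB (rank<⇒¬Indep {X = ⊤}
           (subst (rank M ⊤ <_) (sym (∣p∪⁅x⁆∣≡1+∣p∣ B x∉B)) (s≤s ∣B∣≥)) ⊆⊤)
  ... | D , circ , x∈D , D⊆ with nonempty? ((D ∖ x) ─ cl (I ∖ x))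
  -- If `D ∖ x` lay in the flat `cl (I ∖ x)`, which misses `x`, then adding `x` would make the
  -- circuit `D` independent.
  ...   | no ¬∃ = contradiction
    (hereditary (p⊆[p-x]∪⁅x⁆ D x) (flat-augment (cl-flat (I ∖ x)) (circuit-remove circ x∈D) D-x⊆H x∉H))
    (proj₁ circ)
    where
    D-x⊆H : D ∖ x ⊆ cl (I ∖ x)
    D-x⊆H {y} y∈ with y ∈? cl (I ∖ x)
    ... | yes h = h
    ... | no h = contradiction (y , x∈p∧x∉q⇒x∈p─q y∈ h) ¬∃
    x∉H : x ∉ cl (I ∖ x)
    x∉H x∈H = cl-dependent id (sym (Indep⇒rank≡∣I∣ (hereditary (p─q⊆p I ⁅ x ⁆) ind))) x∈H (x∉p-x I x)
      (hereditary (p∪⁅x⁆⊆q (p─q⊆p I ⁅ x ⁆) x∈I) ind)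
  ...   | yes (y , y∈) with x∈p─q⁻ (D ∖ x) (cl (I ∖ x)) y∈
  ...     | y∈D-x , y∉H with x∈p-y⁻ D x y∈D-x
  ...       | y∈D , y≢x with x∈p∪⁅y⁆⁻ B x (D⊆ y∈D)
  ...         | inj₂ y≡x = contradiction y≡x y≢x
  ...         | inj₁ y∈B with nth-surjective B y∈B
  ...           | i , refl = i , ∈A⁺ (x∉B ∘ p─q⊆p B ⁅ y ⁆) ind′ , y∉H ∘ X⊆cl ,
                    flat-augment (cl-flat (I ∖ x)) (hereditary (p─q⊆p I ⁅ x ⁆) ind) X⊆cl y∉H
    where
    -- A basis of B ∪ ⁅ x ⁆ containing D ∖ y avoids y, so it is all of (B ∖ y) ∪ ⁅ x ⁆.
    ind′ : Indep ((B ∖ y) ∪ ⁅ x ⁆)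
    ind′ with extend-to-basis (circuit-remove circ y∈D) (D⊆ ∘ p─q⊆p D ⁅ y ⁆)
    ... | K , D-y⊆K , K⊆ , indK , K≡ = hereditary (p⊆q∧∣q∣≤∣p∣⇒q⊆p K⊆′ size) indK
      where
      open ℕₚ.≤-Reasoning
      y∉K : y ∉ K
      y∉K y∈K = proj₁ circ (hereditary (p∪⁅x⁆⊆q D-y⊆K y∈K ∘ p⊆[p-x]∪⁅x⁆ D y) indK)
      K⊆′ : K ⊆ (B ∖ y) ∪ ⁅ x ⁆
      K⊆′ {z} z∈K with x∈p∪⁅y⁆⁻ B x (K⊆ z∈K)
      ... | inj₁ z∈B = p⊆p∪q ⁅ x ⁆ (x∈p∧x≢y⇒x∈p-y z∈B λ { refl → y∉K z∈K })
      ... | inj₂ refl = x∈p∪⁅x⁆ (B ∖ y) x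
      size : ∣ (B ∖ y) ∪ ⁅ x ⁆ ∣ ≤ ∣ K ∣
      size = begin
        ∣ (B ∖ y) ∪ ⁅ x ⁆ ∣   ≡⟨ ∣p∪⁅x⁆∣≡1+∣p∣ (B ∖ y) (x∉B ∘ p─q⊆p B ⁅ y ⁆) ⟩
        suc ∣ B ∖ y ∣         ≡⟨ ∣p∣≡1+∣p-x∣ B y∈B ⟨
        ∣ B ∣                 ≤⟨ Indep⇒∣I∣≤rank indB (p⊆p∪q ⁅ x ⁆) ⟩
        rank M (B ∪ ⁅ x ⁆)    ≡⟨ K≡ ⟨
        ∣ K ∣                 ∎

  -- Elements outside `B` are exchanged for members of `B` until the set lies in `B`, where each
  -- `b i` is matched to `i`. Every exchange can be undone in the matching, because `b i` lies in
  -- `A i` only and `x` lies there too.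
  Indep⇒matching : ∀ {I} → Indep I → Matching A I
  Indep⇒matching {I} = go (⊂-wellFounded (I ─ B))
    where
    go : ∀ {I} → Acc _⊂_ (I ─ B) → Indep I → Matching A I
    go {I} (acc rec) ind with nonempty? (I ─ B)
    ... | no ¬∃ = record
      { to = λ x x∈I → proj₁ (index x∈I)
      ; to-∈ = λ x x∈I → let i , e = index x∈I in subst (_∈ A i) e (b∈A i)
      ; injective = λ x y x∈I y∈I e → trans (sym (proj₂ (index x∈I))) (trans (cong b e) (proj₂ (index y∈I)))
      }
      where
      index : ∀ {x} → x ∈ I → ∃[ i ] b i ≡ x
      index {x} x∈I with x ∈? B
      ... | yes x∈B = nth-surjective B x∈B
      ... | no x∉B = contradiction (x , x∈p∧x∉q⇒x∈p─q x∈I x∉B) ¬∃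
    ... | yes (x , x∈) with x∈p─q⁻ I B x∈
    ...   | x∈I , x∉B with symmetric-exchange ind x∈I x∉B
    ...     | i , x∈A , b∉ , ind′ =
      matching-replace A b∉ (λ j b∈A → subst (λ j → x ∈ A j) (sym (b∈A⇒≡ b∈A)) x∈A)
        (go (rec (I′─B⊆ , x , x∈ , x∉I′─B)) ind′)
      where
      I′ = (I ∖ x) ∪ ⁅ b i ⁆
      I′─B⊆ : I′ ─ B ⊆ I ─ B
      I′─B⊆ y∈ with x∈p─q⁻ I′ B y∈
      ... | y∈I′ , y∉B with x∈p∪⁅y⁆⁻ (I ∖ x) (b i) y∈I′
      ...   | inj₁ y∈I-x = x∈p∧x∉q⇒x∈p─q (p─q⊆p I ⁅ x ⁆ y∈I-x) y∉B
      ...   | inj₂ refl = contradiction (nth-∈ B i) y∉B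
      x∉I′─B : x ∉ I′ ─ B
      x∉I′─B x∈′ with x∈p∪⁅y⁆⁻ (I ∖ x) (b i) (proj₁ (x∈p─q⁻ I′ B x∈′))
      ... | inj₁ x∈I-x = x∉p-x I x x∈I-x
      ... | inj₂ refl = x∉B (nth-∈ B i)

  fundamental : IsFundamentalTransversal M
  fundamental = ∣ B ∣ , A ,
    (λ I → mk⇔ (matching⇒partialTransversal A ∘ Indep⇒matching) (matching⇒Indep ∘ partialTransversal⇒matching A)) ,
    λ i → b i , x∈p∧x∉q⇒x∈p─q (b∈A i) λ b∈ → case x∈⋃-others⁻ A i b∈ of λ (j , j≢i , b∈Aj) → j≢i (b∈A⇒≡ b∈Aj)

-- Ordered lists and the minimal members of a family of sets.

AllPairs-lookup : ∀ {A : Set} {R : A → A → Set} {xs} → AllPairs R xs →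
  ∀ {i j} → i Fin.< j → R (lookup xs i) (lookup xs j)
AllPairs-lookup {xs = _ ∷ xs} (Rx ∷ Rxs) {zero} {suc j} _ = All.lookup Rx (∈-lookup {xs = xs} j)
AllPairs-lookup (Rx ∷ Rxs) {suc i} {suc j} (s≤s i<j) = AllPairs-lookup Rxs i<j

p⊆q∧p⊄q⇒q⊆p : ∀ {n} {p q : Subset n} → p ⊆ q → p ⊄ q → q ⊆ p
p⊆q∧p⊄q⇒q⊆p {p = p} p⊆q p⊄q {x} x∈q with x ∈? p
... | yes x∈p = x∈p
... | no x∉p = ⊥-elim (p⊄q (p⊆q , x , x∈q , x∉p))

module _ {n : ℕ} (F : List (Subset n)) where

  minimal? = λ X → ¬? (Any.any? (_⊂? X) F)

  minimals : List (Subset n)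
  minimals = filter minimal? F

  minimals⊆ : ∀ {X} → X List.∈ minimals → X List.∈ F
  minimals⊆ X∈ = proj₁ (∈-filter⁻ minimal? X∈)

  minimals-antichain : ∀ {X Y} → X List.∈ minimals → Y List.∈ minimals → X ⊆ Y → X ≡ Y
  minimals-antichain {X} {Y} X∈ Y∈ X⊆Y = ⊆-antisym X⊆Y (p⊆q∧p⊄q⇒q⊆p X⊆Y λ X⊂Y →
    proj₂ (∈-filter⁻ minimal? {xs = F} Y∈) (Any.map (λ { refl → X⊂Y }) (minimals⊆ X∈)))

  minimal-below : ∀ {X} → X List.∈ F → ∃[ K ] (K List.∈ minimals × K ⊆ X)
  minimal-below {X} = go (⊂-wellFounded X)
    where
    go : ∀ {X} → Acc _⊂_ X → X List.∈ F → ∃[ K ] (K List.∈ minimals × K ⊆ X)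
    go {X} (acc rec) X∈ with Any.any? (_⊂? X) F
    ... | no minimal = X , ∈-filter⁺ minimal? X∈ minimal , id
    ... | yes below with List.find below
    ...   | Y , Y∈ , Y⊂X with go (rec Y⊂X) Y∈
    ...     | K , K∈ , K⊆Y = K , K∈ , proj₁ Y⊂X ∘ K⊆Y

minimals≢[] : ∀ {n} (F : List (Subset n)) → F ≢ [] → minimals F ≢ []
minimals≢[] [] F≢[] = contradiction refl F≢[]
minimals≢[] F@(_ ∷ _) _ e with minimal-below F (here refl)
... | K , K∈ , _ = case subst (K List.∈_) e K∈ of λ ()

-- Möbius weights of the cyclic flats, and sufficiency.

module CyclicFlatWeights {n : ℕ} (M : Matroid n) (flats : List (Subset n))
  (∈flats⁺ : ∀ {X} → IsCyclicFlat M X → X List.∈ flats) (∈flats⁻ : ∀ {X} → X List.∈ flats → IsCyclicFlat M X)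
  (flats-linear-extension : AllPairs (λ p q → q ⊈ p) flats) where

  open Matroid M
  open MatroidTheory M

  private
    r : Subset n → ℕ
    r = rank M

  Z : Fin (length flats) → Subset n
  Z = lookup flats

  Z-cyclicFlat : ∀ i → IsCyclicFlat M (Z i)
  Z-cyclicFlat i = ∈flats⁻ (∈-lookup {xs = flats} i)

  Z-surjective : ∀ {X} → IsCyclicFlat M X → ∃[ i ] X ≡ Z i
  Z-surjective cf = Any.index (∈flats⁺ cf) , lookup-index (∈flats⁺ cf)

  flats-unique : Unique flats
  flats-unique = AllPairs.map (λ q⊈p p≡q → q⊈p (⊆-reflexive (sym p≡q))) flats-linear-extension

  Z-antisym : ∀ {i j} → Z i ⊆ Z j → Z j ⊆ Z i → i ≡ j
  Z-antisym {i} {j} Zi⊆Zj Zj⊆Zi with Fin.<-cmp i j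
  ... | tri< i<j _ _ = ⊥-elim (AllPairs-lookup flats-linear-extension i<j Zj⊆Zi)
  ... | tri≈ _ i≡j _ = i≡j
  ... | tri> _ _ j<i = ⊥-elim (AllPairs-lookup flats-linear-extension j<i Zi⊆Zj)

  above : Fin (length flats) → Subset (length flats)
  above j = comprehension (λ i → Z j ⊆? Z i)

  ∈above⁺ : ∀ {i j} → Z j ⊆ Z i → i ∈ above j
  ∈above⁺ {j = j} Zj⊆Zi = ∈-comprehension⁺ (λ i → Z j ⊆? Z i) (λ {x} → Zj⊆Zi {x})

  ∈above⁻ : ∀ {i j} → i ∈ above j → Z j ⊆ Z i
  ∈above⁻ {j = j} i∈ = ∈-comprehension⁻ (λ i → Z j ⊆? Z i) i∈

  -- Möbius inversion over the lattice of cyclic flats.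
  abstract
    system : ∃[ w ] (∀ j → weight w (above j) ≡ + r ⊤ - + r (Z j))
    system = triangular-system above (λ j → + r ⊤ - + r (Z j))
      (λ i → ∈above⁺ id) (λ i<j i∈ → AllPairs-lookup flats-linear-extension i<j (∈above⁻ i∈))

  w : Fin (length flats) → ℤ
  w = proj₁ system

  weight-above : ∀ j → weight w (above j) ≡ + r ⊤ - + r (Z j)
  weight-above = proj₂ system

  -- At `Z j` this is the complement of `above j`. Complements are taken because they turn unions of
  -- sets into unions of index sets.
  N : Subset n → Subset (length flats)
  N X = comprehension (λ i → ¬? (X ⊆? Z i))

  ∈N⁺ : ∀ {X i} → X ⊈ Z i → i ∈ N X
  ∈N⁺ {X} = ∈-comprehension⁺ (λ i → ¬? (X ⊆? Z i))

  ∈N⁻ : ∀ {X i} → i ∈ N X → X ⊈ Z i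
  ∈N⁻ {X} = ∈-comprehension⁻ (λ i → ¬? (X ⊆? Z i))

  N-mono : ∀ {X Y} → X ⊆ Y → N X ⊆ N Y
  N-mono X⊆Y i∈ = ∈N⁺ λ Y⊆Z → ∈N⁻ i∈ (Y⊆Z ∘ X⊆Y)

  N-⊥ : N ⊥ ≡ ⊥
  N-⊥ = Empty-unique λ (i , i∈) → ∈N⁻ i∈ ⊥⊆

  N-∪ : ∀ X Y → N (X ∪ Y) ≡ N X ∪ N Y
  N-∪ X Y = ⊆-antisym split (∪-lub (N-mono (p⊆p∪q {p = X} Y)) (N-mono (q⊆p∪q X Y)))
    where
    split : N (X ∪ Y) ⊆ N X ∪ N Y
    split {i} i∈ with X ⊆? Z i | Y ⊆? Z i
    ... | no X⊈Z | _ = p⊆p∪q (N Y) (∈N⁺ X⊈Z)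
    ... | _ | no Y⊈Z = q⊆p∪q (N X) (N Y) (∈N⁺ Y⊈Z)
    ... | yes X⊆Z | yes Y⊆Z = ⊥-elim (∈N⁻ i∈ (∪-lub X⊆Z Y⊆Z))

  -- The closure of the empty set is the least cyclic flat: it has rank 0 and all cyclic flats are
  -- above it.
  weight-⊤ : weight w ⊤ ≡ + r ⊤
  weight-⊤ with Z-surjective (cl-cyclicFlat cyclic-⊥)
  ... | j , cl⊥≡Zj = begin
    weight w ⊤           ≡⟨ cong (weight w) (⊆-antisym (λ {i} _ → ∈above⁺ (Zj⊆ i)) ⊆⊤) ⟩
    weight w (above j)   ≡⟨ weight-above j ⟩
    + r ⊤ - + r (Z j)    ≡⟨ cong (λ k → + r ⊤ - + k) rZj≡0 ⟩
    + r ⊤ - 0ℤ           ≡⟨ ℤₚ.+-identityʳ _ ⟩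
    + r ⊤                ∎
    where
    open ≡-Reasoning
    Zj⊆ : ∀ i → Z j ⊆ Z i
    Zj⊆ i = subst (_⊆ Z i) cl⊥≡Zj (cl⊆flat (proj₁ (Z-cyclicFlat i)) ⊥⊆)
    rZj≡0 : r (Z j) ≡ 0
    rZj≡0 = trans (cong r (sym cl⊥≡Zj)) (trans (rank-cl ⊥) (trans (Indep⇒rank≡∣I∣ indep-⊥) (∣⊥∣≡0 n)))

  rank-Z : ∀ j → + r (Z j) ≡ weight w (N (Z j))
  rank-Z j = begin
    + r (Z j)                                             ≡⟨ x≡y-[y-x] (+ r (Z j)) (+ r ⊤) ⟩
    + r ⊤ - (+ r ⊤ - + r (Z j))                           ≡⟨ cong₂ _-_ weight-⊤ (weight-above j) ⟨
    weight w ⊤ - weight w (above j)                       ≡⟨ cong (λ P → weight w P - weight w (above j)) (⊆-antisym ⊆⊤ λ {i} _ → cover i) ⟨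
    weight w (N (Z j) ∪ above j) - weight w (above j)     ≡⟨ cong (_- weight w (above j))
                                                               (weight-∪-disjoint w λ i∈N i∈ → ∈N⁻ i∈N (∈above⁻ i∈)) ⟩
    weight w (N (Z j)) + weight w (above j) - weight w (above j)   ≡⟨ cancel (weight w (N (Z j))) _ ⟩
    weight w (N (Z j))                                    ∎
    where
    open ≡-Reasoning
    x≡y-[y-x] : ∀ x y → x ≡ y - (y - x)
    x≡y-[y-x] = solve-∀
    cancel : ∀ x y → x + y - y ≡ x
    cancel = solve-∀
    cover : ∀ i → i ∈ N (Z j) ∪ above j
    cover i with Z j ⊆? Z i
    ... | yes Zj⊆Zi = q⊆p∪q (N (Z j)) (above j) (∈above⁺ Zj⊆Zi)
    ... | no Zj⊈Zi = p⊆p∪q (above j) (∈N⁺ Zj⊈Zi)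

  -- A flat contains `X` exactly when it contains `cl X`, so passing to the cyclic flat `cl X`
  -- changes neither side. This covers unions of cyclic flats, which need not be flats.
  rank-cyclic : ∀ {X} → IsCyclic M X → + r X ≡ weight w (N X)
  rank-cyclic {X} cX with Z-surjective (cl-cyclicFlat cX)
  ... | j , cl≡Zj = begin
    + r X                 ≡⟨ cong +_ (rank-cl X) ⟨
    + r (cl X)            ≡⟨ cong (λ Y → + r Y) cl≡Zj ⟩
    + r (Z j)             ≡⟨ rank-Z j ⟩
    weight w (N (Z j))    ≡⟨ cong (weight w ∘ N) cl≡Zj ⟨
    weight w (N (cl X))   ≡⟨ cong (weight w) (⊆-antisym N-cl⊆ (N-mono X⊆cl)) ⟩
    weight w (N X)        ∎
    where
    open ≡-Reasoning
    N-cl⊆ : N (cl X) ⊆ N X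
    N-cl⊆ {i} i∈ = ∈N⁺ λ X⊆Z → ∈N⁻ i∈ (cl⊆flat (proj₁ (Z-cyclicFlat i)) X⊆Z)

  ∈⋂N⁺ : ∀ F {i} → (∀ {X} → X List.∈ F → X ⊈ Z i) → i ∈ ⋂ (map N F)
  ∈⋂N⁺ F h = x∈⋂⁺ (map N F) λ X∈ → case ∈-map⁻ N X∈ of λ { (Y , Y∈ , refl) → ∈N⁺ (h Y∈) }

  ∈⋂N⁻ : ∀ F {i} → i ∈ ⋂ (map N F) → ∀ {X} → X List.∈ F → X ⊈ Z i
  ∈⋂N⁻ F i∈ X∈ = ∈N⁻ (⋂⊆ (∈-map⁺ N X∈) i∈)

  -- The index set on the right consists of the cyclic flats that contain no member of `F`.
  alternatingRankSum≡weight : ∀ {F} → All (IsCyclicFlat M) F → F ≢ [] →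
    alternatingRankSum M F ≡ weight w (⋂ (map N F))
  alternatingRankSum≡weight cfs F≢[] = trans
    (alternatingSum-cong (IsCyclic M) cyclic-⊥ cyclic-∪ rank-cyclic (All.map proj₂ cfs))
    (inclusion-exclusion N N-⊥ N-∪ w F≢[])

  -- Both sides depend on the minimal members alone: these have the same intersection as `F`, and a
  -- flat containing a member of `F` contains a minimal one.
  rankEquality-minimals : ∀ {F} → All (IsCyclicFlat M) F → F ≢ [] →
    RankEquality M (minimals F) → RankEquality M F
  rankEquality-minimals {F} cfs F≢[] eq = begin
    + r (⋂ F)                             ≡⟨ cong (λ X → + r X) (⊆-antisym ⋂F⊆ ⋂min⊆) ⟩
    + r (⋂ (minimals F))                  ≡⟨ eq ⟩
    alternatingRankSum M (minimals F)     ≡⟨ alternatingRankSum≡weight (All.filter⁺ (minimal? F) cfs) (minimals≢[] F F≢[]) ⟩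
    weight w (⋂ (map N (minimals F)))     ≡⟨ cong (weight w) (⊆-antisym N-min⊆ N-F⊆) ⟩
    weight w (⋂ (map N F))                ≡⟨ alternatingRankSum≡weight cfs F≢[] ⟨
    alternatingRankSum M F                ∎
    where
    open ≡-Reasoning
    ⋂F⊆ : ⋂ F ⊆ ⋂ (minimals F)
    ⋂F⊆ x∈ = x∈⋂⁺ _ λ X∈ → ⋂⊆ (minimals⊆ F X∈) x∈
    ⋂min⊆ : ⋂ (minimals F) ⊆ ⋂ F
    ⋂min⊆ x∈ = x∈⋂⁺ _ λ X∈ → let K , K∈ , K⊆X = minimal-below F X∈ in K⊆X (⋂⊆ K∈ x∈)
    N-min⊆ : ⋂ (map N (minimals F)) ⊆ ⋂ (map N F)
    N-min⊆ i∈ = ∈⋂N⁺ F λ X∈ X⊆Z →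
      let K , K∈ , K⊆X = minimal-below F X∈ in ∈⋂N⁻ (minimals F) i∈ K∈ (X⊆Z ∘ K⊆X)
    N-F⊆ : ⋂ (map N F) ⊆ ⋂ (map N (minimals F))
    N-F⊆ i∈ = ∈⋂N⁺ (minimals F) λ X∈ → ∈⋂N⁻ F i∈ (minimals⊆ F X∈)

  module _ (filter-equality : ∀ F → IsSetOfCyclicFlats M F → F ≢ [] → IsFilter M F → RankEquality M F) where

    S : Fin (length flats) → List (Subset n)
    S i = filter (λ X → ¬? (X ⊆? Z i)) flats

    ∈S⁺ : ∀ {X i} → IsCyclicFlat M X → X ⊈ Z i → X List.∈ S i
    ∈S⁺ {i = i} cf = ∈-filter⁺ (λ X → ¬? (X ⊆? Z i)) (∈flats⁺ cf)

    ∈S⁻ : ∀ {X i} → X List.∈ S i → X ⊈ Z i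
    ∈S⁻ {i = i} X∈ = proj₂ (∈-filter⁻ (λ X → ¬? (X ⊆? Z i)) {xs = flats} X∈)

    S-set : ∀ i → IsSetOfCyclicFlats M (S i)
    S-set i = Unique.filter⁺ _ flats-unique ,
      All.tabulate λ X∈ → ∈flats⁻ (proj₁ (∈-filter⁻ (λ X → ¬? (X ⊆? Z i)) X∈))

    S-filter : ∀ i → IsFilter M (S i)
    S-filter i X∈ cf X⊆Y = ∈S⁺ cf λ Y⊆Z → ∈S⁻ X∈ (Y⊆Z ∘ X⊆Y)

    Z∷S-set : ∀ i → IsSetOfCyclicFlats M (Z i ∷ S i)
    Z∷S-set i = All.tabulate (λ { X∈ refl → ∈S⁻ {i = i} X∈ id }) ∷ proj₁ (S-set i) ,
                Z-cyclicFlat i ∷ proj₂ (S-set i)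

    -- A cyclic flat above `Z i` either equals `Z i` or is not contained in it.
    Z∷S-filter : ∀ i → IsFilter M (Z i ∷ S i)
    Z∷S-filter i {Y = Y} X∈ cf X⊆Y with Y ⊆? Z i
    ... | no Y⊈Z = there (∈S⁺ cf Y⊈Z)
    Z∷S-filter i (here refl) cf Z⊆Y | yes Y⊆Z = here (⊆-antisym Y⊆Z Z⊆Y)
    Z∷S-filter i (there X∈) cf X⊆Y | yes Y⊆Z = ⊥-elim (∈S⁻ X∈ (Y⊆Z ∘ X⊆Y))

    rank-⋂ : ∀ {F} → IsSetOfCyclicFlats M F → F ≢ [] → IsFilter M F →
      + r (⋂ F) ≡ weight w (⋂ (map N F))
    rank-⋂ {F} set F≢[] fil =
      trans (filter-equality F set F≢[] fil) (alternatingRankSum≡weight (proj₂ set) F≢[])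

    W : Fin (length flats) → Subset n
    W i = ⋂ (S i)

    P : Fin (length flats) → Subset (length flats)
    P i = ⋂ (map N (S i))

    rank-W : ∀ i → + r (W i) ≡ weight w (P i)
    rank-W i with S i | S-set i | S-filter i
    -- `S i` is empty when `Z i` is the greatest cyclic flat. Both empty intersections are `⊤`, and
    -- no rank equality is available.
    ... | [] | _ | _ = sym weight-⊤
    ... | X ∷ F | set | fil = rank-⋂ set (λ ()) fil

    -- `P i` consists of the cyclic flats contained in `Z i`, since any other `Z k` is itself a
    -- member of `S i`. Among these only `Z i` contains `Z i`.
    P-decompose : ∀ i → P i ≡ (N (Z i) ∩ P i) ∪ ⁅ i ⁆
    P-decompose i = ⊆-antisym P⊆ (p∪⁅x⁆⊆q (p∩q⊆q (N (Z i)) (P i)) (∈⋂N⁺ (S i) ∈S⁻))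
      where
      P⊆ : P i ⊆ (N (Z i) ∩ P i) ∪ ⁅ i ⁆
      P⊆ {k} k∈ with Z i ⊆? Z k | Z k ⊆? Z i
      ... | no Zi⊈Zk | _ = p⊆p∪q ⁅ i ⁆ (x∈p∩q⁺ (∈N⁺ Zi⊈Zk , k∈))
      ... | yes _ | no Zk⊈Zi = ⊥-elim (∈⋂N⁻ (S i) k∈ (∈S⁺ (Z-cyclicFlat k) Zk⊈Zi) id)
      ... | yes Zi⊆Zk | yes Zk⊆Zi with Z-antisym Zi⊆Zk Zk⊆Zi
      ...   | refl = x∈p∪⁅x⁆ (N (Z i) ∩ P i) i

    -- The rank formulas for `W i` and `Z i ∩ W i` concern the index sets `P i` and `N (Z i) ∩ P i`,
    -- which differ in `i` alone. Truncated subtraction is exact here because `Z i ∩ W i ⊆ W i`.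
    w-value : ∀ i → w i ≡ + (r (W i) ∸ r (Z i ∩ W i))
    w-value i = begin
      w i                                                    ≡⟨ cancel (w i) (weight w (N (Z i) ∩ P i)) ⟩
      weight w (N (Z i) ∩ P i) + w i - weight w (N (Z i) ∩ P i)
        ≡⟨ cong (λ z → weight w (N (Z i) ∩ P i) + z - weight w (N (Z i) ∩ P i)) (weight-⁅⁆ w i) ⟨
      weight w (N (Z i) ∩ P i) + weight w ⁅ i ⁆ - weight w (N (Z i) ∩ P i)
        ≡⟨ cong (_- weight w (N (Z i) ∩ P i)) (weight-∪-disjoint w disjoint) ⟨
      weight w ((N (Z i) ∩ P i) ∪ ⁅ i ⁆) - weight w (N (Z i) ∩ P i)
        ≡⟨ cong₂ (λ a b → a - b) (trans (rank-W i) (cong (weight w) (P-decompose i)))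
                                 (rank-⋂ (Z∷S-set i) (λ ()) (Z∷S-filter i)) ⟨
      + r (W i) - + r (Z i ∩ W i)                            ≡⟨ ℤₚ.m-n≡m⊖n (r (W i)) (r (Z i ∩ W i)) ⟩
      r (W i) ⊖ r (Z i ∩ W i)                                ≡⟨ ℤₚ.⊖-≥ (rank-mono (p∩q⊆q (Z i) (W i))) ⟩
      + (r (W i) ∸ r (Z i ∩ W i))                            ∎
      where
      open ≡-Reasoning
      cancel : ∀ x y → x ≡ y + x - y
      cancel = solve-∀
      disjoint : ∀ {k} → k ∈ N (Z i) ∩ P i → k ∉ ⁅ i ⁆
      disjoint k∈ k∈⁅i⁆ with x∈⁅y⁆⇒x≡y i k∈⁅i⁆
      ... | refl = ∈N⁻ (proj₁ (x∈p∩q⁻ (N (Z i)) (P i) k∈)) id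

    abstract
      choice : ∀ i → ∃[ q ] (q ⊆ W i ─ Z i × ∣ q ∣ ≡ r (W i) ∸ r (Z i ∩ W i))
      choice i = subset-of-size _ (W i ─ Z i) (ℕₚ.m≤n+o⇒m∸n≤o (r (W i)) (r (Z i ∩ W i))
        (subst (λ X → r (W i) ≤ r X ℕ.+ ∣ W i ─ Z i ∣) (∩-comm (W i) (Z i)) (rank≤rank∩+∣─∣ (W i) (Z i))))

    Bᵢ : Fin (length flats) → Subset n
    Bᵢ i = proj₁ (choice i)

    Bᵢ⊆W : ∀ {i} → Bᵢ i ⊆ W i
    Bᵢ⊆W {i} x∈ = proj₁ (x∈p─q⁻ (W i) (Z i) (proj₁ (proj₂ (choice i)) x∈))

    Bᵢ∩Z : ∀ {i x} → x ∈ Bᵢ i → x ∉ Z i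
    Bᵢ∩Z {i} x∈ = proj₂ (x∈p─q⁻ (W i) (Z i) (proj₁ (proj₂ (choice i)) x∈))

    Bᵢ⊆ : ∀ {i X} → IsCyclicFlat M X → X ⊈ Z i → Bᵢ i ⊆ X
    Bᵢ⊆ cf X⊈Z x∈ = ⋂⊆ (∈S⁺ cf X⊈Z) (Bᵢ⊆W x∈)

    -- If `Z i ⊈ Z j`, then `Z i` belongs to `S j`, so `Bᵢ j ⊆ W j ⊆ Z i`, whereas `Bᵢ i` avoids
    -- `Z i`.
    Bᵢ-disjoint : ∀ {i j x} → x ∈ Bᵢ i → x ∈ Bᵢ j → i ≡ j
    Bᵢ-disjoint {i} {j} x∈Bi x∈Bj with Z i ⊆? Z j | Z j ⊆? Z i
    ... | yes Zi⊆Zj | yes Zj⊆Zi = Z-antisym Zi⊆Zj Zj⊆Zi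
    ... | no Zi⊈Zj | _ = contradiction (Bᵢ⊆ (Z-cyclicFlat i) Zi⊈Zj x∈Bj) (Bᵢ∩Z x∈Bi)
    ... | _ | no Zj⊈Zi = contradiction (Bᵢ⊆ (Z-cyclicFlat j) Zj⊈Zi x∈Bi) (Bᵢ∩Z x∈Bj)

    ∣⋃Bᵢ∣ : ∀ Q → + ∣ ⋃ᵢ Bᵢ Q ∣ ≡ weight w Q
    ∣⋃Bᵢ∣ Q = trans (∣⋃ᵢ∣ Bᵢ Bᵢ-disjoint Q)
      (weight-cong (λ i → trans (cong +_ (proj₂ (proj₂ (choice i)))) (sym (w-value i))) Q)

    rank≡∣⋃Bᵢ∣ : ∀ {X} → IsCyclicFlat M X → r X ≡ ∣ ⋃ᵢ Bᵢ (N X) ∣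
    rank≡∣⋃Bᵢ∣ {X} (_ , cX) = ℤₚ.+-injective (trans (rank-cyclic cX) (sym (∣⋃Bᵢ∣ (N X))))

    B : Subset n
    B = ⋃ᵢ Bᵢ ⊤

    -- For a circuit C ⊆ B, each Bᵢ i that meets C has cl C ⊈ Z i, so C has
    -- at most r (cl C) = r C < ∣ C ∣ elements.
    B-indep : Indep B
    B-indep = decidable-stable (indep? B) λ ¬ind → case ¬Indep⇒circuit ¬ind of λ (C , circ , C⊆B) →
      ℕₚ.<⇒≱ (rank-circuit circ) (begin
        ∣ C ∣                     ≤⟨ p⊆q⇒∣p∣≤∣q∣ (C⊆⋃ C C⊆B) ⟩
        ∣ ⋃ᵢ Bᵢ (N (cl C)) ∣      ≡⟨ rank≡∣⋃Bᵢ∣ (cl-cyclicFlat (cyclic-circuit circ)) ⟨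
        r (cl C)                  ≡⟨ rank-cl C ⟩
        r C                       ∎)
      where
      open ℕₚ.≤-Reasoning
      C⊆⋃ : ∀ C → C ⊆ B → C ⊆ ⋃ᵢ Bᵢ (N (cl C))
      C⊆⋃ C C⊆B x∈C with x∈⋃ᵢ⁻ Bᵢ ⊤ (C⊆B x∈C)
      ... | i , _ , x∈Bi = x∈⋃ᵢ⁺ Bᵢ (∈N⁺ λ cl⊆Z → Bᵢ∩Z x∈Bi (cl⊆Z (X⊆cl x∈C))) x∈Bi

    filter-equality⇒fundamental : IsFundamentalTransversal M
    filter-equality⇒fundamental = FundamentalBasis.fundamental M B B-indep
      (≤-reflexive (sym (ℤₚ.+-injective (trans (∣⋃Bᵢ∣ ⊤) weight-⊤))))
      -- The pieces that add up to the rank of `X` are those with `X ⊈ Z i`; they lie in `W i ⊆ X`.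
      λ {X} cf → subst (_≤ ∣ B ∩ X ∣) (sym (rank≡∣⋃Bᵢ∣ cf)) (p⊆q⇒∣p∣≤∣q∣ (⋃⊆ cf))
      where
      ⋃⊆ : ∀ {X} → IsCyclicFlat M X → ⋃ᵢ Bᵢ (N X) ⊆ B ∩ X
      ⋃⊆ {X} cf x∈ with x∈⋃ᵢ⁻ Bᵢ (N X) x∈
      ... | i , i∈ , x∈Bi = x∈p∩q⁺ (x∈⋃ᵢ⁺ Bᵢ ∈⊤ x∈Bi , Bᵢ⊆ cf (∈N⁻ i∈) x∈Bi)

-- The three equivalences.

theorem4p1 : ∀ {n : ℕ} (M : Matroid n) →
    (IsFundamentalTransversal M ⇔
    (∀ F → IsSetOfCyclicFlats M F → F ≢ [] → RankEquality M F))
    × (IsFundamentalTransversal M ⇔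
    (∀ F → IsSetOfCyclicFlats M F → F ≢ [] → IsAntichain M F → RankEquality M F))
    × (IsFundamentalTransversal M ⇔
    (∀ F → IsSetOfCyclicFlats M F → F ≢ [] → IsFilter M F → RankEquality M F))
theorem4p1 M =
    mk⇔ necessity (λ eq → filter-equality⇒fundamental λ F set F≢[] _ → eq F set F≢[])
  , mk⇔ (λ ft F set F≢[] _ → necessity ft F set F≢[])
        -- The antichain equality is applied to the minimal members of the filter.
        (λ eq → filter-equality⇒fundamental λ F set F≢[] _ →
          rankEquality-minimals (proj₂ set) F≢[]
            (eq (minimals F) (Unique.filter⁺ (minimal? F) (proj₁ set) , All.filter⁺ (minimal? F) (proj₂ set))
                (minimals≢[] F F≢[]) λ {X} {Y} → minimals-antichain F {X} {Y}))
  , mk⇔ (λ ft F set F≢[] _ → necessity ft F set F≢[]) filter-equality⇒fundamental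
  where
  open MatroidTheory M using (cyclicFlat?)
  open CyclicFlatWeights M (filter cyclicFlat? (allSubsets _))
    (∈-filter⁺ cyclicFlat? (∈-allSubsets _))
    (λ X∈ → proj₂ (∈-filter⁻ cyclicFlat? {xs = allSubsets _} X∈))
    (AllPairs.filter⁺ cyclicFlat? (allSubsets-linear-extension _))
  necessity : IsFundamentalTransversal M → ∀ F → IsSetOfCyclicFlats M F → F ≢ [] → RankEquality M F
  necessity (_ , A , presentation , private-element) =
    FundamentalPresentation.rank-equality M A presentation private-element
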